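{- Let $M\in\mathrm{pSh}(\Omega,L)$, let $\bar a$ be a tuple of sections of $M$ and let $\alpha$ be an ordinal. Then for any $N\in\mathrm{pSh}(\Omega,L)$ and any $\bar b\in{}^{\mathrm{lh}(\bar a)}|N|$, setting $p=E\bar a\wedge E\bar b$, one has $F^\alpha_{M,\bar a\upharpoonright p}=F^\alpha_{N,\bar b\upharpoonright p}$ if and only if there is a partial isomorphism $h:\bar a\upharpoonright p\to\bar b\upharpoonright p$ (that is, with $h(a_i\upharpoonright p)=b_i\upharpoonright p$ for all $i<\mathrm{lh}(\bar a)$) such that $h\in Q_\alpha(p)$.
   Context: **Presheaves.** Fix a complete Heyting algebra $\Omega$ (top $\top$) and a cardinal $\mu$. A presheaf $M$ over $\Omega$ is a set $|M|$ of sections with maps $E:|M|\to\Omega$ (extent) and $\upharpoonright:|M|\times\Omega\to|M|$ (restriction) such that $a\upharpoonright Ea=a$, $E(a\upharpoonright p)=Ea\wedge p$, $(a\upharpoonright p)\upharpoonright q=a\upharpoonright(p\wedge q)$. Put $[a=b]_M=\bigvee\{p\le Ea\wedge Eb: a\upharpoonright p=b\upharpoonright p\}$; presheaves are extensional: $Ea=Eb=[a=b]_M$ implies $a=b$. For $p\in\Omega$, $|M\upharpoonright p|=\{a\in|M|:Ea\le p\}$. For a tuple $\bar a=\langle a_i:i<\gamma\rangle$ of sections, $\mathrm{lh}(\bar a)=\gamma$, $E\bar a=\bigwedge_iEa_i$ ($E\emptyset=\top$), $\bar a\upharpoonright p=\langle a_i\upharpoonright p\rangle_i$, $[\bar a=\bar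 b]_M=\bigwedge_i[a_i=b_i]_M$. ${}^{\gamma}X$ (${}^{<\mu}X$) is the set of tuples from $X$ of length $\gamma$ (less than $\mu$). **Tuple convention.** Tuples of sections are taken with all entries of the same extent (i.e. $\bar x$ stands for $\bar x\upharpoonright E\bar x$); for $E\bar c\le E\bar a$ the concatenation $\bar a\bar c$ stands for $(\bar a\upharpoonright E\bar c)$ followed by $\bar c$. **Structures.** A signature has finitary relation symbols, finitary function symbols and a presheaf over $\Omega$ of constant symbols (so each constant $c$ has an extent $Ec$). An element $M$ of $\mathrm{pSh}(\Omega,L)$ is a presheaf with: for each $n$-ary $R$ a map $R^M:|M|^n\to\Omega$ with $R^M(\bar a)\le E\bar a$ and $[\bar a=\bar b]_M\wedge R^M(\bar a)\le R^M(\bar b)$; for each $n$-ary $f$ a map $f^M:|M|^n\to|M|$ with $Ef^M(\bar a)=E\bar a$ and $[\bar a=\bar b]_M\le[f^M(\bar a)=f^M(\bar b)]_M$; for each constant $c$ a section $\mathfrak c^M$ with $E\mathfrak c^M=Ec$, compatibly with restriction. **Unnested atomic formulae** are those of the forms $v_i=v_j$, $v_i=c$, $R(v_{i_0},\dots,v_{i_{n-1}})$, $v_{i_n}=f(v_{i_0},\dots,v_{i_{n-1}})$. Their value $[\psi(\bar x)]_M\in\Omega$ at sections $\bar x$ is respectively $[x_i=x_j]_M$, $[x_i=\mathfrak c^M]_M$, $R^M(x_{i_0},\dots)$, $[x_{i_n}=f^M(x_{i_0},\dots)]_M$. **Partial isomorphisms.** For $A\subseteq|M|$, $\langle A\rangle=\{a\upharpoonright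 p:a\in A,p\in\Omega\}$. A partial isomorphism $h:M\to N$ is a bijection $h:A\to B$, $A\subseteq|M|$, $B\subseteq|N|$, with $[a_0=a_1]_M=[h(a_0)=h(a_1)]_N$ on $A$, such that, extending $h$ to $\langle A\rangle$ by $h(a\upharpoonright p)=h(a)\upharpoonright p$, every unnested atomic $\psi$ satisfies $[\psi(\bar x)]_M=[\psi(h(\bar x))]_N$ for all tuples $\bar x$ from $\langle A\rangle$. Domains, ranges, values and inclusions below refer to the extended maps; $h_q$ is the restriction of $h$ to sections of extent exactly $q$. **$Q_\alpha(p)$.** $Q_0(p)$ is the class of all partial isomorphisms between elements of $\mathrm{pSh}(\Omega,L)$; $Q_\alpha(p)=\bigcap_{\beta<\alpha}Q_\beta(p)$ for limit $\alpha$; $h:M\to N$ is in $Q_{\beta+1}(p)$ iff $h\in Q_\beta(p)$ and: (Forth) for every nonempty $\bar c=\langle c_i:i<\gamma\rangle$, $\gamma<\mu$, from $|M\upharpoonright p|$ there is a set $\{(h_j,q_j,\bar d_j):j\in J\}$ such that for each $j$: $h_j:M\to N$ is in $Q_\beta(q_j)$, $h_{q_j}\subseteq h_j$, $\bar d_j=\langle d_{ji}:i<\gamma\rangle$ is from $|N\upharpoonright E\bar c|$, $E\bar d_j=q_j$, $c_i\upharpoonright q_j\in\mathrm{dom}(h_j)$ and $h_j(c_i\upharpoonright q_j)=d_{ji}$ for all $i<\gamma$; and $\bigvee_jq_j=E\bar c$; (Back) for every nonempty $\bar d=\langle d_i:i<\gamma\rangle$, $\gamma<\mu$, from $|N\upharpoonright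 p|$ there is a set $\{(h_j,q_j,\bar c_j):j\in J\}$ such that for each $j$: $h_j\in Q_\beta(q_j)$, $h_{q_j}\subseteq h_j$, $\bar c_j=\langle c_{ji}\rangle$ is from $|M\upharpoonright E\bar d|$, $E\bar c_j=q_j$, $h_j(c_{ji})=d_i\upharpoonright q_j$ for all $i$; and $\bigvee_jq_j=E\bar d$. **Functions $F^\alpha_{M,\bar a}$** (values in $\Omega$). $F^0_{M,\bar a}=I_{M,\bar a}$, where $I_{M,\bar a}$ has as domain all $(\psi,f)$ with $\psi$ an unnested atomic formula whose variables are exactly $v_0,\dots,v_{n-1}$ for some $n\in\omega$, and $f:\{0,\dots,n-1\}\to\mathrm{lh}(\bar a)$, and $I_{M,\bar a}(\psi,f)=[\psi(a_{f(0)},\dots,a_{f(n-1)})]_M$. At limits take unions. $F^{\alpha+1}_{M,\bar a}$ extends $F^\alpha_{M,\bar a}$ by new arguments $(F^\alpha_{K,\bar s\bar t},\alpha)$ where $K\in\mathrm{pSh}(\Omega,L)$, $\bar s\in{}^{\mathrm{lh}(\bar a)}|K|$, $\bar t\in{}^{<\mu}|K|$ is nonempty and $E\bar t\le E\bar a\wedge E\bar s$, with (well-defined) value $F^{\alpha+1}_{M,\bar a}(F^\alpha_{K,\bar s\bar t},\alpha)=\bigvee\{E\bar c:\bar c\in{}^{\mathrm{lh}(\bar t)}|M|,\ E\bar c\le E\bar t,\ F^\alpha_{K,(\bar s\bar t)\upharpoonright E\bar c}=F^\alpha_{M,\bar a\bar c}\}$. -}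

module Defs where

open import Level using (Level; Lift; lift; lower; _⊔_) renaming (suc to lsuc)
open import Data.Nat.Base using (ℕ)
open import Data.Fin.Base using (Fin)
open import Data.Vec.Base using (Vec; lookup; toList)
open import Data.List.Base using (List; []; _∷_)
open import Data.List.Membership.Propositional using (_∈_)
open import Data.Product using (Σ; Σ-syntax; ∃; _×_; _,_; proj₁; proj₂)
open import Data.Sum using (_⊎_; inj₁; inj₂; [_,_])
open import Data.Refinement using (Refinement; Refinement-syntax)
open import Data.Unit.Polymorphic using (⊤)
open import Data.Empty.Polymorphic using (⊥)
open import Function.Base using (_∘_)
open import Function.Bundles using (_⤖_; Bijection)
open import Induction.WellFounded using (WellFounded)
open import Relation.Binary.Bundles using (Setoid)
open import Relation.Binary.Core using (Rel)
open import Relation.Binary.Structures using (IsStrictTotalOrder)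
open import Relation.Binary.Lattice.Bundles using (HeytingAlgebra)
import Relation.Binary.Lattice.Properties.MeetSemilattice as MeetProperties
import Relation.Binary.Construct.On as On
open import Relation.Binary.PropositionalEquality using (_≡_; subst)
open import Relation.Nullary using (¬_)
open import Relation.Unary using (Pred)

-- Throughout, `Set ℓ` plays the rôle of the universe of sets.

-- Ordinals as lengths of tuples: well-ordered sets.  `↓ x` is the set of
-- predecessors of x, so that for an ordinal μ the ordinals γ < μ are
-- exactly the `↓ m` with m an element of μ.

record WellOrder (ℓ : Level) : Set (lsuc ℓ) where
  field
    Carrier            : Set ℓ
    _<_                : Rel Carrier ℓ
    isStrictTotalOrder : IsStrictTotalOrder _≡_ _<_
    wellFounded        : WellFounded _<_

  ↓_ : Carrier → Set ℓ
  ↓ m = [ x ∈ Carrier ∣ x < m ]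

-- A cardinal is an initial ordinal.

record Cardinal (ℓ : Level) : Set (lsuc ℓ) where
  field
    wellOrder : WellOrder ℓ
  open WellOrder wellOrder public
  field
    initial : ∀ m → ¬ (Carrier ⤖ (↓ m))

-- Ordinals as stages of a transfinite recursion: trees generated by zero,
-- successors and suprema of nonempty set-indexed families.  The families
-- are not required to be increasing: the constructions recursing over
-- `Ord` below are monotone in the stage, so that the clause for limits is
-- correct at every nonempty supremum.

data Ord (ℓ : Level) : Set (lsuc ℓ) where
  zeroᵒ : Ord ℓ
  sucᵒ  : Ord ℓ → Ord ℓ
  limᵒ  : (A : Set ℓ) → A → (A → Ord ℓ) → Ord ℓ

-- Every family of truth values has a supremum.  The index types live in
-- `Set (lsuc ℓ)` because suprema are needed of subsets of Ω that are
-- defined by quantifying over the class of all structures; classically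
-- these are just subsets of Ω.

record CompleteHeytingAlgebra (ℓ : Level) : Set (lsuc (lsuc ℓ)) where
  field
    heytingAlgebra : HeytingAlgebra ℓ ℓ ℓ
  open HeytingAlgebra heytingAlgebra public renaming (⊤ to 𝟙; ⊥ to 𝟘)
  field
    ⋁       : {J : Set (lsuc ℓ)} → (J → Carrier) → Carrier
    ⋁-upper : {J : Set (lsuc ℓ)} (f : J → Carrier) → ∀ j → f j ≤ ⋁ f
    ⋁-least : {J : Set (lsuc ℓ)} (f : J → Carrier) →
              ∀ x → (∀ j → f j ≤ x) → ⋁ f ≤ x

  ⋁ₛ : {J : Set ℓ} → (J → Carrier) → Carrier
  ⋁ₛ {J} f = ⋁ {Lift (lsuc ℓ) J} (f ∘ lower)

  ⋀ : {J : Set ℓ} → (J → Carrier) → Carrier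
  ⋀ {J} f = ⋁ₛ {Σ[ x ∈ Carrier ] (∀ j → x ≤ f j)} proj₁

  ⋀-lower : {J : Set ℓ} (f : J → Carrier) → ∀ j → ⋀ f ≤ f j
  ⋀-lower f j = ⋁-least _ (f j) (λ k → proj₂ (lower k) j)

  ⋀-greatest : {J : Set ℓ} (f : J → Carrier) →
               ∀ x → (∀ j → x ≤ f j) → x ≤ ⋀ f
  ⋀-greatest f x x≤f = ⋁-upper (proj₁ ∘ lower) (lift (x , x≤f))

module _ {ℓ : Level} (Ω : CompleteHeytingAlgebra ℓ) where

  private module Ω = CompleteHeytingAlgebra Ω
  open Ω using (_≤_; _∧_) renaming (Carrier to ∣Ω∣; _≈_ to _≈Ω_)

  record Presheaf : Set (lsuc ℓ) where
    infixl 8 _↾_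
    field
      sections : Setoid ℓ ℓ
    open Setoid sections public
    field
      E      : Carrier → ∣Ω∣
      _↾_    : Carrier → ∣Ω∣ → Carrier
      E-cong : ∀ {a b} → a ≈ b → E a ≈Ω E b
      ↾-cong : ∀ {a b p q} → a ≈ b → p ≈Ω q → a ↾ p ≈ b ↾ q
      ↾-E    : ∀ a → a ↾ E a ≈ a
      E-↾    : ∀ a p → E (a ↾ p) ≈Ω E a ∧ p
      ↾-↾    : ∀ a p q → (a ↾ p) ↾ q ≈ a ↾ (p ∧ q)

    ⟦_≐_⟧ : Carrier → Carrier → ∣Ω∣
    ⟦ a ≐ b ⟧ =
      Ω.⋁ₛ {Σ[ p ∈ ∣Ω∣ ] (p ≤ E a ∧ E b × a ↾ p ≈ b ↾ p)} proj₁

    field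
      extensional : ∀ a b → E a ≈Ω E b → E b ≈Ω ⟦ a ≐ b ⟧ → a ≈ b

    E⃗ : {I : Set ℓ} → (I → Carrier) → ∣Ω∣
    E⃗ a = Ω.⋀ (E ∘ a)

    ⟦_≐⃗_⟧ : {I : Set ℓ} → (I → Carrier) → (I → Carrier) → ∣Ω∣
    ⟦ a ≐⃗ b ⟧ = Ω.⋀ (λ i → ⟦ a i ≐ b i ⟧)

  record Signature : Set (lsuc ℓ) where
    field
      RelSym FunSym : Set ℓ
      arityᴿ        : RelSym → ℕ
      arityᶠ        : FunSym → ℕ
      constants     : Presheaf
    module Const = Presheaf constants

  Fin′ : ℕ → Set ℓ
  Fin′ n = Lift ℓ (Fin n)

  module WithSignature (L : Signature) where

    open Signature L

    -- Congruence of Rᴹ and fᴹ for the equality of sections follows from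
    -- the conditions R-resp and f-resp, f-extent.

    record Structure : Set (lsuc ℓ) where
      field
        presheaf : Presheaf
      open Presheaf presheaf public
      field
        ⟦_⟧ᴿ     : ∀ R → (Fin′ (arityᴿ R) → Carrier) → ∣Ω∣
        R-extent : ∀ R a → ⟦ R ⟧ᴿ a ≤ E⃗ a
        R-resp   : ∀ R a b → ⟦ a ≐⃗ b ⟧ ∧ ⟦ R ⟧ᴿ a ≤ ⟦ R ⟧ᴿ b
        ⟦_⟧ᶠ     : ∀ f → (Fin′ (arityᶠ f) → Carrier) → Carrier
        f-extent : ∀ f a → E (⟦ f ⟧ᶠ a) ≈Ω E⃗ a
        f-resp   : ∀ f a b → ⟦ a ≐⃗ b ⟧ ≤ ⟦ ⟦ f ⟧ᶠ a ≐ ⟦ f ⟧ᶠ b ⟧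
        ⟦_⟧ᶜ     : Const.Carrier → Carrier
        c-cong   : ∀ {c d} → c Const.≈ d → ⟦ c ⟧ᶜ ≈ ⟦ d ⟧ᶜ
        c-extent : ∀ c → E ⟦ c ⟧ᶜ ≈Ω Const.E c
        c-↾      : ∀ c p → ⟦ c Const.↾ p ⟧ᶜ ≈ ⟦ c ⟧ᶜ ↾ p

    -- The variables occurring are among v₀, …, vₙ₋₁ (not necessarily all).

    data Unnested (n : ℕ) : Set ℓ where
      var≐var : Fin n → Fin n → Unnested n
      var≐con : Fin n → Const.Carrier → Unnested n
      rel     : (R : RelSym) → Vec (Fin n) (arityᴿ R) → Unnested n
      var≐fun : Fin n → (f : FunSym) → Vec (Fin n) (arityᶠ f) → Unnested n

    variables : ∀ {n} → Unnested n → List (Fin n)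
    variables (var≐var i j)    = i ∷ j ∷ []
    variables (var≐con i c)    = i ∷ []
    variables (rel R is)       = toList is
    variables (var≐fun i f is) = i ∷ toList is

    -- Equality of formulae: symbols for constants are compared by the
    -- equality of the presheaf of constant symbols.

    data _≈ψ_ {n : ℕ} : Unnested n → Unnested n → Set ℓ where
      var≐var : ∀ i j → var≐var i j ≈ψ var≐var i j
      var≐con : ∀ i {c d} → c Const.≈ d → var≐con i c ≈ψ var≐con i d
      rel     : ∀ R is → rel R is ≈ψ rel R is
      var≐fun : ∀ i f is → var≐fun i f is ≈ψ var≐fun i f is

    module _ (M : Structure) where
      open Structure M

      ⟦_⟧ψ : ∀ {n} → Unnested n → (Fin′ n → Carrier) → ∣Ω∣
      ⟦ var≐var i j ⟧ψ    x = ⟦ x (lift i) ≐ x (lift j) ⟧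
      ⟦ var≐con i c ⟧ψ    x = ⟦ x (lift i) ≐ ⟦ c ⟧ᶜ ⟧
      ⟦ rel R is ⟧ψ       x = ⟦ R ⟧ᴿ (λ k → x (lift (lookup is (lower k))))
      ⟦ var≐fun i f is ⟧ψ x =
        ⟦ x (lift i) ≐ ⟦ f ⟧ᶠ (λ k → x (lift (lookup is (lower k)))) ⟧

    -- By convention all entries of a tuple have the same extent.

    record Tuple (M : Structure) (I : Set ℓ) : Set ℓ where
      open Structure M
      field
        at      : I → Carrier
        uniform : ∀ i j → E (at i) ≈Ω E (at j)

    open Tuple public

    module _ {M : Structure} where
      open Structure M hiding (_↾_) renaming (E to E₁)
      private module M = Structure M

      infixl 8 _↾_

      E : {I : Set ℓ} → Tuple M I → ∣Ω∣
      E a = E⃗ (at a)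

      _↾_ : {I : Set ℓ} → Tuple M I → ∣Ω∣ → Tuple M I
      at      (a ↾ p) i   = at a i M.↾ p
      uniform (a ↾ p) i j =
        Ω.Eq.trans (E-↾ (at a i) p)
          (Ω.Eq.trans (∧-cong (uniform a i j) Ω.Eq.refl)
                      (Ω.Eq.sym (E-↾ (at a j) p)))
        where open MeetProperties Ω.meetSemilattice using (∧-cong)

      -- The concatenation āc̄.  On index sets the ordinal sum is the
      -- disjoint union.
      concat : {I J : Set ℓ} (a : Tuple M I) (c : Tuple M J) →
               E c ≤ E a → Tuple M (I ⊎ J)
      at      (concat a c _)   = [ (λ i → at a i M.↾ E c) , at c ]
      uniform (concat a c c≤a) k l =
        Ω.Eq.trans (extent k) (Ω.Eq.sym (extent l))
        where
        extent : ∀ k → E₁ (at (concat a c c≤a) k) ≈Ω E c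
        extent (inj₁ i) = Ω.Eq.trans (E-↾ (at a i) (E c))
          (Ω.antisym (Ω.x∧y≤y _ _)
            (Ω.∧-greatest (Ω.trans c≤a (Ω.⋀-lower _ i)) Ω.refl))
        extent (inj₂ j) = Ω.antisym
          (Ω.⋀-greatest _ _ (λ i → Ω.reflexive (uniform c j i)))
          (Ω.⋀-lower _ j)

    record PartialBijection (M N : Structure) : Set (lsuc ℓ) where
      private
        module M = Structure M
        module N = Structure N
      field
        A : Pred M.Carrier ℓ
        B : Pred N.Carrier ℓ
        bijection :
          Bijection (On.setoid M.sections (proj₁ {B = A}))
                    (On.setoid N.sections (proj₁ {B = B}))

      -- ⟨A⟩, and the extension of the map to ⟨A⟩.

      h₀ : ∃ A → N.Carrier
      h₀ a = proj₁ (Bijection.to bijection a)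

      dom : Pred M.Carrier ℓ
      dom x = Σ[ a ∈ ∃ A ] Σ[ p ∈ ∣Ω∣ ] x M.≈ proj₁ a M.↾ p

      apply : ∀ {x} → dom x → N.Carrier
      apply (a , p , _) = h₀ a N.↾ p

      _↦_ : M.Carrier → N.Carrier → Set ℓ
      x ↦ y = Σ[ x∈ ∈ dom x ] apply x∈ N.≈ y

    record PartialIso (M N : Structure) : Set (lsuc ℓ) where
      private
        module M = Structure M
        module N = Structure N
      field
        partialBijection : PartialBijection M N
      open PartialBijection partialBijection public
      field
        ≐-preserving : ∀ (a₀ a₁ : ∃ A) →
          M.⟦ proj₁ a₀ ≐ proj₁ a₁ ⟧ ≈Ω N.⟦ h₀ a₀ ≐ h₀ a₁ ⟧
        ψ-preserving : ∀ {n} (ψ : Unnested n) (x : Tuple M (Fin′ n))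
          (x∈ : ∀ k → dom (at x k)) →
          ⟦ M ⟧ψ ψ (at x) ≈Ω ⟦ N ⟧ψ ψ (λ k → apply (x∈ k))

    _⟨_⟩↦_ : ∀ {M N} → Structure.Carrier M → PartialIso M N →
             Structure.Carrier N → Set ℓ
    x ⟨ h ⟩↦ y = PartialIso._↦_ h x y

    -- h_q ⊆ k
    RestrictionAt_Of_⊆_ : ∀ {M N} → ∣Ω∣ → PartialIso M N → PartialIso M N →
                          Set ℓ
    RestrictionAt_Of_⊆_ {M} q h k =
      ∀ x (x∈ : PartialIso.dom h x) → Structure.E M x ≈Ω q →
      x ⟨ k ⟩↦ PartialIso.apply h x∈

    module WithCardinal (μ : Cardinal ℓ) where

      open Cardinal μ using (↓_) renaming (Carrier to ∣μ∣)

      -- An index set J may, like those of suprema in Ω, be any type in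
      -- `Set (lsuc ℓ)`.

      module _ {M N : Structure} (h : PartialIso M N) (p : ∣Ω∣)
               (Qᵝ : ∣Ω∣ → PartialIso M N → Set (lsuc (lsuc ℓ))) where
        private
          module M = Structure M
          module N = Structure N

        Forth : Set (lsuc (lsuc ℓ))
        Forth =
          ∀ (m : ∣μ∣) → (↓ m) → (c : Tuple M (↓ m)) →
          (∀ i → M.E (at c i) ≤ p) →
          Σ[ J ∈ Set (lsuc ℓ) ]
          Σ[ k ∈ (J → PartialIso M N) ]
          Σ[ q ∈ (J → ∣Ω∣) ]
          Σ[ d ∈ (J → Tuple N (↓ m)) ]
            (∀ j → Qᵝ (q j) (k j)
                 × RestrictionAt q j Of h ⊆ k j
                 × (∀ i → N.E (at (d j) i) ≤ E c)
                 × E (d j) ≈Ω q j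
                 × (∀ i → (at c i M.↾ q j) ⟨ k j ⟩↦ at (d j) i))
            × Ω.⋁ q ≈Ω E c

        Back : Set (lsuc (lsuc ℓ))
        Back =
          ∀ (m : ∣μ∣) → (↓ m) → (d : Tuple N (↓ m)) →
          (∀ i → N.E (at d i) ≤ p) →
          Σ[ J ∈ Set (lsuc ℓ) ]
          Σ[ k ∈ (J → PartialIso M N) ]
          Σ[ q ∈ (J → ∣Ω∣) ]
          Σ[ c ∈ (J → Tuple M (↓ m)) ]
            (∀ j → Qᵝ (q j) (k j)
                 × RestrictionAt q j Of h ⊆ k j
                 × (∀ i → M.E (at (c j) i) ≤ E d)
                 × E (c j) ≈Ω q j
                 × (∀ i → at (c j) i ⟨ k j ⟩↦ (at d i N.↾ q j)))
            × Ω.⋁ q ≈Ω E d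

      Q : Ord ℓ → ∣Ω∣ → {M N : Structure} → PartialIso M N →
          Set (lsuc (lsuc ℓ))
      Q zeroᵒ        p h = ⊤
      Q (sucᵒ β)     p h = Q β p h × Forth h p (λ q k → Q β q k)
                                   × Back h p (λ q k → Q β q k)
      Q (limᵒ A _ α) p h = ∀ i → Q (α i) p h

      -- The domain of I_{M,ā} for lh(ā) = γ.

      record Arg₀ (γ : Set ℓ) : Set ℓ where
        constructor arg₀
        field
          {n}   : ℕ
          ψ     : Unnested n
          exact : ∀ i → i ∈ variables ψ
          f     : Fin′ n → γ

      data _≈Arg₀_ {γ : Set ℓ} : Arg₀ γ → Arg₀ γ → Set ℓ where
        same : ∀ {n} {ψ ψ′ : Unnested n} {e e′} {f f′ : Fin′ n → γ} →
               ψ ≈ψ ψ′ → (∀ k → f k ≡ f′ k) →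
               arg₀ ψ e f ≈Arg₀ arg₀ ψ′ e′ f′

      -- The F^α are hereditarily functions: an argument of F^α is either
      -- an element of dom I or a pair (F^β, β).  They are represented, as
      -- in set theory, by graphs: a family of argument-value pairs, with
      -- two graphs being equal if they have the same pairs.  The type
      -- `Graph γ` records the length γ of the tuple ā from which F^α_{M,ā}
      -- is formed; it is determined by dom I.  The tag β of (F^β, β) is
      -- compared as a tree: distinct trees for the same ordinal merely
      -- give rise to duplicate arguments with equal values.

      data Graph (γ : Set ℓ) : Set (lsuc (lsuc ℓ))

      data Arg (γ : Set ℓ) : Set (lsuc (lsuc ℓ)) where
        base  : Arg₀ γ → Arg γ
        stage : (m : ∣μ∣) → Graph (γ ⊎ (↓ m)) → Ord ℓ → Arg γ

      data Graph γ where
        graph : (X : Set (lsuc ℓ)) → (X → Arg γ) → (X → ∣Ω∣) → Graph γ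

      infix 4 _≈G_ _≈Arg_

      _≈G_   : ∀ {γ} → Graph γ → Graph γ → Set (lsuc ℓ)
      _≈Arg_ : ∀ {γ} → Arg γ → Arg γ → Set (lsuc ℓ)

      graph X x v ≈G graph Y y w =
          (∀ i → Σ[ j ∈ Y ] (x i ≈Arg y j × v i ≈Ω w j))
        × (∀ j → Σ[ i ∈ X ] (x i ≈Arg y j × v i ≈Ω w j))

      base a      ≈Arg base b         = Lift (lsuc ℓ) (a ≈Arg₀ b)
      stage m G α ≈Arg stage m′ G′ α′ =
        (Σ[ e ∈ m′ ≡ m ] G ≈G subst (λ l → Graph (_ ⊎ (↓ l))) e G′) × α ≡ α′
      base _      ≈Arg stage _ _ _    = ⊥
      stage _ _ _ ≈Arg base _         = ⊥

      _∪_ : ∀ {γ} → Graph γ → Graph γ → Graph γ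
      graph X x v ∪ graph Y y w = graph (X ⊎ Y) [ x , y ] [ v , w ]

      ⋃ : ∀ {γ} {A : Set ℓ} → (A → Graph γ) → Graph γ
      ⋃ {γ} {A} G = graph (Σ[ i ∈ A ] X (G i)) (λ (i , k) → x (G i) k)
                                               (λ (i , k) → v (G i) k)
        where
        X : Graph γ → Set (lsuc ℓ)
        X (graph Y _ _) = Y
        x : (H : Graph γ) → X H → Arg γ
        x (graph _ y _) = y
        v : (H : Graph γ) → X H → ∣Ω∣
        v (graph _ _ w) = w

      I : (M : Structure) {γ : Set ℓ} → Tuple M γ → Graph γ
      I M {γ} a = graph (Lift (lsuc ℓ) (Arg₀ γ)) (base ∘ lower)
        (λ (lift (arg₀ ψ _ f)) → ⟦ M ⟧ψ ψ (λ k → at a (f k)))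

      -- The triples (K, s̄, t̄) giving rise to the new arguments of
      -- F^{α+1}_{M,ā}, where γ = lh(ā) and e = Eā.

      record NewArg (γ : Set ℓ) (e : ∣Ω∣) : Set (lsuc ℓ) where
        field
          K        : Structure
          s        : Tuple K γ
          m        : ∣μ∣
          t        : Tuple K (↓ m)
          nonempty : ↓ m
          bound    : E t ≤ e ∧ E s

        t≤e : E t ≤ e
        t≤e = Ω.trans bound (Ω.x∧y≤x _ _)

        st : Tuple K (γ ⊎ (↓ m))
        st = concat s t (Ω.trans bound (Ω.x∧y≤y _ _))

      F : Ord ℓ → (M : Structure) {γ : Set ℓ} → Tuple M γ → Graph γ
      F zeroᵒ        M     a = I M a
      F (limᵒ A _ α) M     a = ⋃ (λ i → F (α i) M a)
      F (sucᵒ α)     M {γ} a = F α M a ∪ graph (NewArg γ (E a)) argument value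
        where
        argument : NewArg γ (E a) → Arg γ
        argument x = stage m (F α K st) α
          where open NewArg x

        value : NewArg γ (E a) → ∣Ω∣
        value x = Ω.⋁
          {Σ[ c ∈ Tuple M (↓ m) ] Σ[ c≤t ∈ E c ≤ E t ]
             F α K (st ↾ E c) ≈G F α M (concat a c (Ω.trans c≤t t≤e))}
          (λ (c , _) → E c)
          where open NewArg x

{-# OPTIONS --safe #-}
module Submission where

-- Unfolding the recursion over α, F^α_{M,ā} = F^α_{N,b̄} says that ā and b̄ have
-- the same values of unnested formulae and that F^{β+1}_{M,ā} and F^{β+1}_{N,b̄}
-- take the same values on their new arguments for every stage β below α;
-- likewise h ∈ Q_α(p) says that (Forth) and (Back) hold at every such β.
--
-- From equal functions to Q_α: the map aᵢ ↦ bᵢ is a partial isomorphism by the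
-- equality of the I's.  For a tuple c̄ of M, F^{β+1}_{M,ā} takes the value Ec̄ at
-- the argument (F^β_{M,āc̄}, β), hence so does F^{β+1}_{N,b̄}; the tuples d̄ whose
-- extents have this supremum are the answers demanded by (Forth), the maps h_j
-- coming from the induction hypothesis for β.
--
-- From Q_α to equal functions: an answer d̄_j to c̄ gives, by the induction
-- hypothesis, F^β_{M,(āc̄)↾q_j} = F^β_{N,b̄d̄_j}, so every c̄ contributing to a value
-- of F^{β+1}_{M,ā} is covered by tuples contributing to the same value of
-- F^{β+1}_{N,b̄}.
--
-- Both directions need that equality of F^α is preserved by restriction, which
-- also makes the values of F^{α+1} at the new arguments well-defined.

open import Defs
open import Level using (Level; lift; lower) renaming (suc to lsuc)
open import Data.Empty.Polymorphic using (⊥)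
open import Data.Nat.Base as ℕ using ()
open import Data.Fin.Base using (zero; suc)
open import Data.List.Membership.Propositional using (_∈_)
open import Data.List.Relation.Unary.Any using (here; there)
open import Data.Product using (Σ; Σ-syntax; _×_; _,_; proj₁; proj₂)
open import Data.Sum using (_⊎_; inj₁; inj₂)
open import Data.Unit.Polymorphic using (tt)
open import Data.Vec.Base using (lookup; tabulate; []; _∷_)
open import Data.Vec.Properties using (lookup∘tabulate)
open import Data.Vec.Membership.Propositional.Properties using (∈-tabulate⁺; ∈-toList⁺)
open import Function.Base using (_∘_; id)
open import Function.Bundles using (_⇔_; mk⇔)
open import Induction.WellFounded using (WellFounded; Acc; acc; module All)
open import Relation.Unary using (Pred)
open import Relation.Binary.PropositionalEquality as ≡ using (_≡_)
import Relation.Binary.Lattice.Properties.MeetSemilattice as MeetProperties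

-- Complete Heyting algebras.

module CompleteHeytingAlgebraProperties {ℓ : Level} (Ω : CompleteHeytingAlgebra ℓ) where

  open CompleteHeytingAlgebra Ω
  open MeetProperties meetSemilattice public using (∧-cong; ∧-comm; ∧-assoc)

  -- The infinite distributive law, from the adjunction between meet and implication.
  ⋁-∧-least : {J : Set (lsuc ℓ)} (f : J → Carrier) {x y : Carrier} →
              (∀ j → f j ∧ x ≤ y) → ⋁ f ∧ x ≤ y
  ⋁-∧-least f h = transpose-∧ (⋁-least f _ (λ j → transpose-⇨ (h j)))

  ⋀-cong : {J : Set ℓ} {f g : J → Carrier} → (∀ j → f j ≈ g j) → ⋀ f ≈ ⋀ g
  ⋀-cong f≈g = antisym
    (⋀-greatest _ _ (λ j → trans (⋀-lower _ j) (reflexive (f≈g j))))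
    (⋀-greatest _ _ (λ j → trans (⋀-lower _ j) (reflexive (Eq.sym (f≈g j)))))

  ⋀-∧ : {J : Set ℓ} (f g : J → Carrier) → ⋀ (λ j → f j ∧ g j) ≈ ⋀ f ∧ ⋀ g
  ⋀-∧ f g = antisym
    (∧-greatest (⋀-greatest _ _ (λ j → trans (⋀-lower _ j) (x∧y≤x _ _)))
                (⋀-greatest _ _ (λ j → trans (⋀-lower _ j) (x∧y≤y _ _))))
    (⋀-greatest _ _ (λ j → ∧-greatest (trans (x∧y≤x _ _) (⋀-lower _ j))
                                      (trans (x∧y≤y _ _) (⋀-lower _ j))))

  ∧-monotonicˡ : ∀ {x y z} → x ≤ y → x ∧ z ≤ y ∧ z
  ∧-monotonicˡ x≤y = ∧-greatest (trans (x∧y≤x _ _) x≤y) (x∧y≤y _ _)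

  y≤x⇒x∧y≈y : ∀ {x y} → y ≤ x → x ∧ y ≈ y
  y≤x⇒x∧y≈y y≤x = antisym (x∧y≤y _ _) (∧-greatest y≤x refl)

-- Truth values of equations in a presheaf.

module PresheafProperties {ℓ : Level} (Ω : CompleteHeytingAlgebra ℓ) (P : Presheaf Ω) where

  private module Ω = CompleteHeytingAlgebra Ω
  open Ω using (_≤_; _∧_) renaming (_≈_ to _≈Ω_)
  open CompleteHeytingAlgebraProperties Ω
  open Presheaf P

  ≐-intro : ∀ {a b p} → p ≤ E a ∧ E b → a ↾ p ≈ b ↾ p → p ≤ ⟦ a ≐ b ⟧
  ≐-intro {p = p} p≤ eq = Ω.⋁-upper _ (lift (p , p≤ , eq))

  ≐≤E : ∀ {a b} → ⟦ a ≐ b ⟧ ≤ E a ∧ E b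
  ≐≤E = Ω.⋁-least _ _ (λ (lift (_ , p≤ , _)) → p≤)

  ≐-sym : ∀ {a b} → ⟦ a ≐ b ⟧ ≤ ⟦ b ≐ a ⟧
  ≐-sym = Ω.⋁-least _ _ λ (lift (p , p≤ , eq)) →
    ≐-intro (Ω.trans p≤ (Ω.reflexive (∧-comm _ _))) (sym eq)

  -- Distributivity reduces this to single witnesses `p` and `q`; at their meet all three sections
  -- have the same restriction.
  ≐-trans : ∀ {a b c} → ⟦ a ≐ b ⟧ ∧ ⟦ b ≐ c ⟧ ≤ ⟦ a ≐ c ⟧
  ≐-trans {a} {b} {c} = ⋁-∧-least _ λ (lift (p , p≤ , a≈b)) →
    Ω.trans (Ω.reflexive (∧-comm _ _)) (⋁-∧-least _ λ (lift (q , q≤ , b≈c)) →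
    ≐-intro
      (Ω.∧-greatest (Ω.trans (Ω.x∧y≤y _ _) (Ω.trans p≤ (Ω.x∧y≤x _ _)))
                    (Ω.trans (Ω.x∧y≤x _ _) (Ω.trans q≤ (Ω.x∧y≤y _ _))))
      (begin
        a ↾ (q ∧ p) ≈⟨ ↾-cong refl (∧-comm q p) ⟩
        a ↾ (p ∧ q) ≈⟨ ↾-↾ a p q ⟨
        a ↾ p ↾ q   ≈⟨ ↾-cong a≈b Ω.Eq.refl ⟩
        b ↾ p ↾ q   ≈⟨ ↾-↾ b p q ⟩
        b ↾ (p ∧ q) ≈⟨ ↾-cong refl (∧-comm p q) ⟩
        b ↾ (q ∧ p) ≈⟨ ↾-↾ b q p ⟨
        b ↾ q ↾ p   ≈⟨ ↾-cong b≈c Ω.Eq.refl ⟩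
        c ↾ q ↾ p   ≈⟨ ↾-↾ c q p ⟩
        c ↾ (q ∧ p) ∎))
    where open import Relation.Binary.Reasoning.Setoid sections

  ≐-mono : ∀ {a a′ b b′} → a ≈ a′ → b ≈ b′ → ⟦ a ≐ b ⟧ ≤ ⟦ a′ ≐ b′ ⟧
  ≐-mono a≈ b≈ = Ω.⋁-least _ _ λ (lift (p , p≤ , eq)) →
    ≐-intro (Ω.trans p≤ (Ω.reflexive (∧-cong (E-cong a≈) (E-cong b≈))))
            (trans (↾-cong (sym a≈) Ω.Eq.refl) (trans eq (↾-cong b≈ Ω.Eq.refl)))

  ≐-cong : ∀ {a a′ b b′} → a ≈ a′ → b ≈ b′ → ⟦ a ≐ b ⟧ ≈Ω ⟦ a′ ≐ b′ ⟧
  ≐-cong a≈ b≈ = Ω.antisym (≐-mono a≈ b≈) (≐-mono (sym a≈) (sym b≈))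

  ≐-refl : ∀ a → ⟦ a ≐ a ⟧ ≈Ω E a
  ≐-refl a = Ω.antisym (Ω.trans ≐≤E (Ω.x∧y≤x _ _))
                       (≐-intro (Ω.∧-greatest Ω.refl Ω.refl) refl)

  E≤≐ : ∀ {a b} → a ≈ b → E a ≤ ⟦ a ≐ b ⟧
  E≤≐ a≈b = Ω.trans (Ω.reflexive (Ω.Eq.sym (≐-refl _))) (≐-mono refl a≈b)

  -- Extensionality with only the inequality that needs proof; `≐≤E` supplies the other.
  ≐⇒≈ : ∀ {a b} → E a ≈Ω E b → E b ≤ ⟦ a ≐ b ⟧ → a ≈ b
  ≐⇒≈ Ea≈Eb Eb≤ = extensional _ _ Ea≈Eb
    (Ω.antisym Eb≤ (Ω.trans ≐≤E (Ω.x∧y≤y _ _)))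

  ↾-absorb : ∀ {a q} → E a ≤ q → a ↾ q ≈ a
  ↾-absorb {a} {q} Ea≤q = begin
    a ↾ q         ≈⟨ ↾-cong (↾-E a) Ω.Eq.refl ⟨
    a ↾ E a ↾ q   ≈⟨ ↾-↾ a (E a) q ⟩
    a ↾ (E a ∧ q) ≈⟨ ↾-cong refl (Ω.Eq.trans (∧-comm _ _) (y≤x⇒x∧y≈y Ea≤q)) ⟩
    a ↾ E a       ≈⟨ ↾-E a ⟩
    a             ∎
    where open import Relation.Binary.Reasoning.Setoid sections

  ↾-↾-≤ : ∀ {a p q} → q ≤ p → a ↾ p ↾ q ≈ a ↾ q
  ↾-↾-≤ q≤p = trans (↾-↾ _ _ _) (↾-cong refl (y≤x⇒x∧y≈y q≤p))

  E-↾-≤ : ∀ {a q} → q ≤ E a → E (a ↾ q) ≈Ω q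
  E-↾-≤ q≤ = Ω.Eq.trans (E-↾ _ _) (y≤x⇒x∧y≈y q≤)

  -- A restriction is determined by its extent, so the arbitrary exponent found in a proof of `dom`
  -- can be traded for the extent.
  ↾-extent : ∀ {x a r q} → x ≈ a ↾ r → E x ≈Ω q → x ≈ a ↾ q
  ↾-extent {x} {a} {r} {q} x≈ Ex≈q = begin
    x         ≈⟨ ↾-absorb (Ω.reflexive Ex≈q) ⟨
    x ↾ q     ≈⟨ ↾-cong x≈ Ω.Eq.refl ⟩
    a ↾ r ↾ q ≈⟨ ↾-↾-≤ q≤r ⟩
    a ↾ q     ∎
    where
    open import Relation.Binary.Reasoning.Setoid sections
    q≤r : q ≤ r
    q≤r = Ω.trans (Ω.reflexive (Ω.Eq.trans (Ω.Eq.sym Ex≈q)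
            (Ω.Eq.trans (E-cong x≈) (E-↾ a r)))) (Ω.x∧y≤y _ _)

  ↾≐self : ∀ a q → E (a ↾ q) ≤ ⟦ a ↾ q ≐ a ⟧
  ↾≐self a q = ≐-intro
    (Ω.∧-greatest Ω.refl (Ω.trans (Ω.reflexive (E-↾ a q)) (Ω.x∧y≤x _ _)))
    (↾-↾-≤ (Ω.trans (Ω.reflexive (E-↾ a q)) (Ω.x∧y≤y _ _)))

  -- Transitivity through `↾≐self`, which equates a section with its restriction wherever the latter
  -- exists.
  ≐-↾ˡ : ∀ a b q → ⟦ a ↾ q ≐ b ⟧ ≈Ω ⟦ a ≐ b ⟧ ∧ q
  ≐-↾ˡ a b q = Ω.antisym
    (Ω.∧-greatest
      (Ω.trans (Ω.∧-greatest (Ω.trans ≤E (Ω.trans (↾≐self a q) ≐-sym)) Ω.refl) ≐-trans)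
      (Ω.trans ≤E (Ω.trans (Ω.reflexive (E-↾ a q)) (Ω.x∧y≤y _ _))))
    (Ω.trans (Ω.∧-greatest
      (Ω.trans (∧-monotonicˡ (Ω.trans ≐≤E (Ω.x∧y≤x _ _)))
        (Ω.trans (Ω.reflexive (Ω.Eq.sym (E-↾ a q))) (↾≐self a q)))
      (Ω.x∧y≤x _ _)) ≐-trans)
    where
    ≤E : ⟦ a ↾ q ≐ b ⟧ ≤ E (a ↾ q)
    ≤E = Ω.trans ≐≤E (Ω.x∧y≤x _ _)

  ≐-↾ : ∀ a b q r → ⟦ a ↾ q ≐ b ↾ r ⟧ ≈Ω ⟦ a ≐ b ⟧ ∧ (q ∧ r)
  ≐-↾ a b q r = begin
    ⟦ a ↾ q ≐ b ↾ r ⟧   ≈⟨ ≐-↾ˡ a (b ↾ r) q ⟩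
    ⟦ a ≐ b ↾ r ⟧ ∧ q   ≈⟨ ∧-cong (Ω.antisym ≐-sym ≐-sym) Ω.Eq.refl ⟩
    ⟦ b ↾ r ≐ a ⟧ ∧ q   ≈⟨ ∧-cong (≐-↾ˡ b a r) Ω.Eq.refl ⟩
    (⟦ b ≐ a ⟧ ∧ r) ∧ q ≈⟨ ∧-assoc _ _ _ ⟩
    ⟦ b ≐ a ⟧ ∧ (r ∧ q) ≈⟨ ∧-cong (Ω.antisym ≐-sym ≐-sym) (∧-comm r q) ⟩
    ⟦ a ≐ b ⟧ ∧ (q ∧ r) ∎
    where open import Relation.Binary.Reasoning.Setoid Ω.setoid

-- Values of unnested formulae under restriction.

module StructureProperties {ℓ : Level} (Ω : CompleteHeytingAlgebra ℓ) (L : Signature Ω) where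

  private module Ω = CompleteHeytingAlgebra Ω
  open Ω using (_≤_; _∧_) renaming (Carrier to ∣Ω∣; _≈_ to _≈Ω_)
  open CompleteHeytingAlgebraProperties Ω
  open Signature L
  open WithSignature Ω L hiding (E; _↾_)

  -- The factor by which the value of a formula shrinks when each variable `k` is restricted to
  -- `q k`. Exponents may differ between variables, as they do for tuples from the closure of a
  -- domain under restriction; constants stay unrestricted.
  weight : ∀ {n} → Unnested n → (Fin′ Ω n → ∣Ω∣) → ∣Ω∣
  weight (var≐var i j)    q = q (lift i) ∧ q (lift j)
  weight (var≐con i c)    q = q (lift i)
  weight (rel R is)       q = Ω.⋀ {Fin′ Ω (arityᴿ R)} (λ k → q (lift (lookup is (lower k))))
  weight (var≐fun i f is) q =
    q (lift i) ∧ Ω.⋀ {Fin′ Ω (arityᶠ f)} (λ k → q (lift (lookup is (lower k))))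

  module Interpretation (M : Structure) where

    open Structure M
    open PresheafProperties Ω presheaf public

    -- By `R-extent` the value of `R` lies below the extents, which for equal sections lie below
    -- `⟦ x ≐⃗ y ⟧`; so `R-resp` applies.
    R-mono : ∀ R {x y} → (∀ k → x k ≈ y k) → ⟦ R ⟧ᴿ x ≤ ⟦ R ⟧ᴿ y
    R-mono R {x} {y} x≈y = Ω.trans
      (Ω.∧-greatest (Ω.trans (R-extent R x)
        (Ω.⋀-greatest _ _ (λ k → Ω.trans (Ω.⋀-lower _ k) (E≤≐ (x≈y k))))) Ω.refl)
      (R-resp R x y)

    R-cong : ∀ R {x y} → (∀ k → x k ≈ y k) → ⟦ R ⟧ᴿ x ≈Ω ⟦ R ⟧ᴿ y
    R-cong R x≈y = Ω.antisym (R-mono R x≈y) (R-mono R (sym ∘ x≈y))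

    f-cong : ∀ f {x y} → (∀ k → x k ≈ y k) → ⟦ f ⟧ᶠ x ≈ ⟦ f ⟧ᶠ y
    f-cong f {x} {y} x≈y = ≐⇒≈
      (Ω.Eq.trans (f-extent f x)
        (Ω.Eq.trans (⋀-cong (E-cong ∘ x≈y)) (Ω.Eq.sym (f-extent f y))))
      (Ω.trans (Ω.reflexive (f-extent f y))
        (Ω.trans (Ω.⋀-greatest _ _ (λ k →
          Ω.trans (Ω.⋀-lower _ k) (Ω.trans (E≤≐ (sym (x≈y k))) ≐-sym)))
        (f-resp f x y)))

    R-↾ : ∀ R x q → ⟦ R ⟧ᴿ (λ k → x k ↾ q k) ≈Ω ⟦ R ⟧ᴿ x ∧ Ω.⋀ q
    R-↾ R x q = Ω.antisym
      (Ω.∧-greatest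
        (Ω.trans (Ω.∧-greatest (Ω.trans (R-extent R _)
          (Ω.⋀-greatest _ _ (λ k → Ω.trans (Ω.⋀-lower _ k) (↾≐self (x k) (q k))))) Ω.refl)
          (R-resp R _ _))
        (Ω.trans (R-extent R _) (Ω.trans (Ω.reflexive E⃗-↾) (Ω.x∧y≤y _ _))))
      (Ω.trans (Ω.∧-greatest
        (Ω.trans (∧-monotonicˡ (R-extent R x))
          (Ω.trans (Ω.reflexive (Ω.Eq.sym E⃗-↾)) (Ω.⋀-greatest _ _ (λ k →
            Ω.trans (Ω.⋀-lower _ k) (Ω.trans (↾≐self (x k) (q k)) ≐-sym)))))
        (Ω.x∧y≤x _ _)) (R-resp R _ _))
      where
      E⃗-↾ : E⃗ (λ k → x k ↾ q k) ≈Ω E⃗ x ∧ Ω.⋀ q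
      E⃗-↾ = Ω.Eq.trans (⋀-cong (λ k → E-↾ (x k) (q k))) (⋀-∧ _ _)

    f-↾ : ∀ f x q → ⟦ f ⟧ᶠ (λ k → x k ↾ q k) ≈ ⟦ f ⟧ᶠ x ↾ Ω.⋀ q
    f-↾ f x q = ≐⇒≈ extent (Ω.trans
      (Ω.∧-greatest
        (Ω.trans (Ω.reflexive (Ω.Eq.trans (Ω.Eq.sym extent) (f-extent f _)))
          (Ω.trans (Ω.⋀-greatest _ _ (λ k →
            Ω.trans (Ω.⋀-lower _ k) (↾≐self (x k) (q k)))) (f-resp f _ _)))
        (Ω.trans (↾≐self (⟦ f ⟧ᶠ x) (Ω.⋀ q)) ≐-sym))
      ≐-trans)
      where
      extent : E (⟦ f ⟧ᶠ (λ k → x k ↾ q k)) ≈Ω E (⟦ f ⟧ᶠ x ↾ Ω.⋀ q)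
      extent = begin
        E (⟦ f ⟧ᶠ (λ k → x k ↾ q k)) ≈⟨ f-extent f _ ⟩
        E⃗ (λ k → x k ↾ q k)          ≈⟨ ⋀-cong (λ k → E-↾ (x k) (q k)) ⟩
        Ω.⋀ (λ k → E (x k) ∧ q k)    ≈⟨ ⋀-∧ _ _ ⟩
        E⃗ x ∧ Ω.⋀ q                  ≈⟨ ∧-cong (f-extent f x) Ω.Eq.refl ⟨
        E (⟦ f ⟧ᶠ x) ∧ Ω.⋀ q         ≈⟨ E-↾ _ _ ⟨
        E (⟦ f ⟧ᶠ x ↾ Ω.⋀ q)         ∎
        where open import Relation.Binary.Reasoning.Setoid Ω.setoid

    ψ-cong : ∀ {n} (ψ : Unnested n) {x y} → (∀ k → x k ≈ y k) →
             ⟦ M ⟧ψ ψ x ≈Ω ⟦ M ⟧ψ ψ y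
    ψ-cong (var≐var i j)    x≈y = ≐-cong (x≈y _) (x≈y _)
    ψ-cong (var≐con i c)    x≈y = ≐-cong (x≈y _) refl
    ψ-cong (rel R is)       x≈y = R-cong R (λ k → x≈y _)
    ψ-cong (var≐fun i f is) x≈y = ≐-cong (x≈y _) (f-cong f (λ k → x≈y _))

    ψ-resp-≈ψ : ∀ {n} {ψ ψ′ : Unnested n} → ψ ≈ψ ψ′ → ∀ x → ⟦ M ⟧ψ ψ x ≈Ω ⟦ M ⟧ψ ψ′ x
    ψ-resp-≈ψ (var≐var i j)    x = Ω.Eq.refl
    ψ-resp-≈ψ (var≐con i c≈d)  x = ≐-cong refl (c-cong c≈d)
    ψ-resp-≈ψ (rel R is)       x = Ω.Eq.refl
    ψ-resp-≈ψ (var≐fun i f is) x = Ω.Eq.refl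

    -- Restriction changes a value by a factor independent of the structure, so equality of values
    -- at a tuple passes to all restrictions of its entries.
    ψ-↾ : ∀ {n} (ψ : Unnested n) x q →
          ⟦ M ⟧ψ ψ (λ k → x k ↾ q k) ≈Ω ⟦ M ⟧ψ ψ x ∧ weight ψ q
    ψ-↾ (var≐var i j)    x q = ≐-↾ _ _ _ _
    ψ-↾ (var≐con i c)    x q = ≐-↾ˡ _ _ _
    ψ-↾ (rel R is)       x q = R-↾ R _ _
    ψ-↾ (var≐fun i f is) x q = Ω.Eq.trans (≐-cong refl (f-↾ f _ _)) (≐-↾ _ _ _ _)

  -- Tuples of the same unnested type and the isomorphism between them.

  record SameType {M N : Structure} {γ : Set ℓ} (a : Tuple M γ) (b : Tuple N γ) : Set ℓ where
    private
      module M = Structure M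
      module N = Structure N
      module Mₚ = Interpretation M
      module Nₚ = Interpretation N
    field
      exact-same : ∀ {n} (ψ : Unnested n) → (∀ i → i ∈ variables ψ) → (f : Fin′ Ω n → γ) →
                   ⟦ M ⟧ψ ψ (at a ∘ f) ≈Ω ⟦ N ⟧ψ ψ (at b ∘ f)

    -- Formulae not mentioning all their variables, or mentioning them out of
    -- order, are substitution instances of exact ones.
    ψ-same : ∀ {n} (ψ : Unnested n) (f : Fin′ Ω n → γ) →
             ⟦ M ⟧ψ ψ (at a ∘ f) ≈Ω ⟦ N ⟧ψ ψ (at b ∘ f)
    ψ-same (var≐var i j) f =
      exact-same {2} (var≐var zero (suc zero))
        (λ { zero → here ≡.refl ; (suc zero) → there (here ≡.refl) })
        (λ k → lookup (f (lift i) ∷ f (lift j) ∷ []) (lower k))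
    ψ-same (var≐con i c) f =
      exact-same {1} (var≐con zero c) (λ { zero → here ≡.refl }) (λ _ → f (lift i))
    ψ-same (rel R is) f = Ω.Eq.trans (Ω.Eq.sym (Mₚ.R-cong R (M.reflexive ∘ ≡.cong (at a) ∘ arg)))
      (Ω.Eq.trans
        -- Each argument place gets a variable of its own; repetitions in `is` move into the
        -- substitution `g`.
        (exact-same (rel R (tabulate id)) (λ i → ∈-toList⁺ (∈-tabulate⁺ id i)) g)
        (Nₚ.R-cong R (N.reflexive ∘ ≡.cong (at b) ∘ arg)))
      where
      g : Fin′ Ω (arityᴿ R) → γ
      g k = f (lift (lookup is (lower k)))
      arg : ∀ k → g (lift (lookup (tabulate id) (lower k))) ≡ g k
      arg k = ≡.cong (g ∘ lift) (lookup∘tabulate id (lower k))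
    ψ-same (var≐fun i h is) f = Ω.Eq.trans
      (Mₚ.≐-cong M.refl (M.sym (Mₚ.f-cong h (M.reflexive ∘ ≡.cong (at a) ∘ arg))))
      (Ω.Eq.trans
        (exact-same (var≐fun zero h (tabulate suc))
          (λ { zero → here ≡.refl ; (suc i) → there (∈-toList⁺ (∈-tabulate⁺ suc i)) }) g)
        (Nₚ.≐-cong N.refl (Nₚ.f-cong h (N.reflexive ∘ ≡.cong (at b) ∘ arg))))
      where
      g : Fin′ Ω (ℕ.suc (arityᶠ h)) → γ
      g (lift zero)    = f (lift i)
      g (lift (suc k)) = f (lift (lookup is k))
      arg : ∀ k → g (lift (lookup (tabulate suc) (lower k))) ≡ f (lift (lookup is (lower k)))
      arg k = ≡.cong (g ∘ lift) (lookup∘tabulate suc (lower k))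

    ≐-same : ∀ i j → M.⟦ at a i ≐ at a j ⟧ ≈Ω N.⟦ at b i ≐ at b j ⟧
    ≐-same i j = ψ-same {2} (var≐var zero (suc zero)) (λ k → lookup (i ∷ j ∷ []) (lower k))

    E-same : ∀ i → M.E (at a i) ≈Ω N.E (at b i)
    E-same i = Ω.Eq.trans (Ω.Eq.sym (Mₚ.≐-refl _)) (Ω.Eq.trans (≐-same i i) (Nₚ.≐-refl _))

    -- Equality of sections means equal extents on which the equation holds fully, and both are
    -- preserved. This makes `tupleIso` well defined and injective.
    ≈-same : ∀ i j → at a i M.≈ at a j → at b i N.≈ at b j
    ≈-same i j a≈ = Nₚ.≐⇒≈
      (Ω.Eq.trans (Ω.Eq.sym (E-same i)) (Ω.Eq.trans (M.E-cong a≈) (E-same j)))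
      (Ω.trans (Ω.reflexive (Ω.Eq.trans (Ω.Eq.sym (E-same j)) (M.E-cong (M.sym a≈))))
        (Ω.trans (Mₚ.E≤≐ a≈) (Ω.reflexive (≐-same i j))))

  SameType-sym : ∀ {M N γ} {a : Tuple M γ} {b : Tuple N γ} → SameType a b → SameType b a
  SameType-sym s = record { exact-same = λ ψ e f → Ω.Eq.sym (SameType.exact-same s ψ e f) }

  module _ {M N : Structure} {γ : Set ℓ} (a : Tuple M γ) (b : Tuple N γ) (s : SameType a b) where
    private
      module M = Structure M
      module N = Structure N
      module Mₚ = Interpretation M
      module Nₚ = Interpretation N
    open SameType

    -- Membership in `A` carries an index `i`, so the map is simply `at b i`; by `≈-same` a section
    -- listed several times causes no conflict.
    tupleIso : PartialIso M N
    tupleIso = record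
      { partialBijection = record
        { A = λ x → Σ[ i ∈ γ ] x M.≈ at a i
        ; B = λ y → Σ[ i ∈ γ ] y N.≈ at b i
        ; bijection = record
          { to   = λ (_ , i , _) → at b i , i , N.refl
          ; cong = λ { {_ , i , x≈} {_ , j , y≈} x≈y →
              ≈-same s i j (M.trans (M.sym x≈) (M.trans x≈y y≈)) }
          ; bijective =
              (λ { {_ , i , x≈} {_ , j , y≈} b≈ →
                M.trans x≈ (M.trans (≈-same (SameType-sym s) i j b≈) (M.sym y≈)) })
            , (λ { (_ , i , y≈) → (at a i , i , M.refl) , λ { {_ , j , x≈} x≈a →
                N.trans (≈-same s j i (M.trans (M.sym x≈) x≈a)) (N.sym y≈) } })
          }
        }
      ; ≐-preserving = λ { (_ , i , x≈) (_ , j , y≈) →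
          Ω.Eq.trans (Mₚ.≐-cong x≈ y≈) (≐-same s i j) }
      ; ψ-preserving = λ ψ x x∈ → Ω.Eq.trans
          (Mₚ.ψ-cong ψ λ k → let ((_ , _ , x≈) , _ , eq) = x∈ k in
            M.trans eq (M.↾-cong x≈ Ω.Eq.refl))
          -- Both values are those at the unrestricted entries, met with the same `weight`.
          (Ω.Eq.trans (Mₚ.ψ-↾ ψ _ _)
          (Ω.Eq.trans (∧-cong (ψ-same s ψ (λ k → proj₁ (proj₂ (proj₁ (x∈ k))))) Ω.Eq.refl)
          (Ω.Eq.sym (Nₚ.ψ-↾ ψ _ _))))
      }

    tupleIso-maps : ∀ i → at a i ⟨ tupleIso ⟩↦ at b i
    tupleIso-maps i = ((_ , i , M.refl) , M.E (at a i) , M.sym (M.↾-E _)) ,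
      Nₚ.↾-absorb (Ω.reflexive (Ω.Eq.sym (E-same s i)))

module BackAndForth {ℓ : Level} (Ω : CompleteHeytingAlgebra ℓ) (L : Signature Ω) (μ : Cardinal ℓ) where

  private module Ω = CompleteHeytingAlgebra Ω
  open Ω using (_≤_; _∧_) renaming (Carrier to ∣Ω∣; _≈_ to _≈Ω_)
  open CompleteHeytingAlgebraProperties Ω
  open WithSignature Ω L
  open WithCardinal μ
  open StructureProperties Ω L
  open Cardinal μ using (↓_) renaming (Carrier to ∣μ∣)

  -- Equality of graphs.

  ≈Arg₀-refl : ∀ {γ} (a : Arg₀ γ) → a ≈Arg₀ a
  ≈Arg₀-refl (arg₀ ψ _ f) = same (≈ψ-refl ψ) (λ _ → ≡.refl)
    where
    ≈ψ-refl : ∀ {n} (ψ : Unnested n) → ψ ≈ψ ψ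
    ≈ψ-refl (var≐var i j)    = var≐var i j
    ≈ψ-refl (var≐con i c)    = var≐con i (Presheaf.refl (Signature.constants L))
    ≈ψ-refl (rel R is)       = rel R is
    ≈ψ-refl (var≐fun i f is) = var≐fun i f is

  ≈Arg₀-sym : ∀ {γ} {a b : Arg₀ γ} → a ≈Arg₀ b → b ≈Arg₀ a
  ≈Arg₀-sym (same ψ≈ f≡) = same (≈ψ-sym ψ≈) (≡.sym ∘ f≡)
    where
    ≈ψ-sym : ∀ {n} {ψ χ : Unnested n} → ψ ≈ψ χ → χ ≈ψ ψ
    ≈ψ-sym (var≐var i j)    = var≐var i j
    ≈ψ-sym (var≐con i c≈d)  = var≐con i (Presheaf.sym (Signature.constants L) c≈d)
    ≈ψ-sym (rel R is)       = rel R is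
    ≈ψ-sym (var≐fun i f is) = var≐fun i f is

  ≈Arg₀-trans : ∀ {γ} {a b c : Arg₀ γ} → a ≈Arg₀ b → b ≈Arg₀ c → a ≈Arg₀ c
  ≈Arg₀-trans (same ψ≈ f≡) (same χ≈ g≡) =
    same (≈ψ-trans ψ≈ χ≈) (λ k → ≡.trans (f≡ k) (g≡ k))
    where
    ≈ψ-trans : ∀ {n} {ψ χ ω : Unnested n} → ψ ≈ψ χ → χ ≈ψ ω → ψ ≈ψ ω
    ≈ψ-trans (var≐var i j)    (var≐var .i .j)     = var≐var i j
    ≈ψ-trans (var≐con i c≈d)  (var≐con .i d≈e)    =
      var≐con i (Presheaf.trans (Signature.constants L) c≈d d≈e)
    ≈ψ-trans (rel R is)       (rel .R .is)        = rel R is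
    ≈ψ-trans (var≐fun i f is) (var≐fun .i .f .is) = var≐fun i f is

  ≈G-refl   : ∀ {γ} (G : Graph γ) → G ≈G G
  ≈Arg-refl : ∀ {γ} (k : Arg γ) → k ≈Arg k
  ≈G-refl (graph X x v) = (λ i → i , ≈Arg-refl (x i) , Ω.Eq.refl) ,
                          (λ i → i , ≈Arg-refl (x i) , Ω.Eq.refl)
  ≈Arg-refl (base a)      = lift (≈Arg₀-refl a)
  ≈Arg-refl (stage m G α) = (≡.refl , ≈G-refl G) , ≡.refl

  ≈G-sym   : ∀ {γ} (G H : Graph γ) → G ≈G H → H ≈G G
  ≈Arg-sym : ∀ {γ} (k l : Arg γ) → k ≈Arg l → l ≈Arg k
  ≈G-sym (graph X x v) (graph Y y w) (f , g) =
    (λ j → let (i , k≈ , v≈) = g j in i , ≈Arg-sym (x i) (y j) k≈ , Ω.Eq.sym v≈) ,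
    (λ i → let (j , k≈ , v≈) = f i in j , ≈Arg-sym (x i) (y j) k≈ , Ω.Eq.sym v≈)
  ≈Arg-sym (base a)      (base b)       (lift a≈b)              = lift (≈Arg₀-sym a≈b)
  ≈Arg-sym (stage m G α) (stage .m H β) ((≡.refl , G≈H) , α≡β) =
    (≡.refl , ≈G-sym G H G≈H) , ≡.sym α≡β

  ≈G-trans   : ∀ {γ} (G H K : Graph γ) → G ≈G H → H ≈G K → G ≈G K
  ≈Arg-trans : ∀ {γ} (k l m : Arg γ) → k ≈Arg l → l ≈Arg m → k ≈Arg m
  ≈G-trans (graph X x u) (graph Y y v) (graph Z z w) (f , g) (f′ , g′) =
    (λ i → let (j , k≈ , v≈) = f i; (l , k≈′ , v≈′) = f′ j in
       l , ≈Arg-trans (x i) (y j) (z l) k≈ k≈′ , Ω.Eq.trans v≈ v≈′) ,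
    (λ l → let (j , k≈′ , v≈′) = g′ l; (i , k≈ , v≈) = g j in
       i , ≈Arg-trans (x i) (y j) (z l) k≈ k≈′ , Ω.Eq.trans v≈ v≈′)
  ≈Arg-trans (base a) (base b) (base c) (lift a≈b) (lift b≈c) = lift (≈Arg₀-trans a≈b b≈c)
  ≈Arg-trans (stage m G α) (stage .m H β) (stage .m K δ)
    ((≡.refl , G≈H) , α≡β) ((≡.refl , H≈K) , β≡δ) =
    (≡.refl , ≈G-trans G H K G≈H H≈K) , ≡.trans α≡β β≡δ

  -- Membership up to equality of argument and value; through it, equality of graphs becomes mutual
  -- inclusion.
  _∋⟨_,_⟩ : ∀ {γ} → Graph γ → Arg γ → ∣Ω∣ → Set (lsuc ℓ)
  graph X x v ∋⟨ k , w ⟩ = Σ[ i ∈ X ] (x i ≈Arg k × v i ≈Ω w)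

  ≈G⇒⊆ : ∀ {γ} (G H : Graph γ) → G ≈G H → ∀ {k w} → G ∋⟨ k , w ⟩ → H ∋⟨ k , w ⟩
  ≈G⇒⊆ (graph X x v) (graph Y y w) (f , _) (i , k≈ , v≈) =
    let (j , k≈′ , v≈′) = f i in
    j , ≈Arg-trans (y j) (x i) _ (≈Arg-sym (x i) (y j) k≈′) k≈ , Ω.Eq.trans (Ω.Eq.sym v≈′) v≈

  ⊆-antisym : ∀ {γ} (G H : Graph γ) → (∀ {k w} → G ∋⟨ k , w ⟩ → H ∋⟨ k , w ⟩) →
              (∀ {k w} → H ∋⟨ k , w ⟩ → G ∋⟨ k , w ⟩) → G ≈G H
  ⊆-antisym (graph X x v) (graph Y y w) G⊆H H⊆G =
    (λ i → let (j , k≈ , v≈) = G⊆H (i , ≈Arg-refl (x i) , Ω.Eq.refl) in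
       j , ≈Arg-sym (y j) (x i) k≈ , Ω.Eq.sym v≈) ,
    (λ j → H⊆G (j , ≈Arg-refl (y j) , Ω.Eq.refl))

  ∪⁻ : ∀ {γ} (G H : Graph γ) {k w} → (G ∪ H) ∋⟨ k , w ⟩ → G ∋⟨ k , w ⟩ ⊎ H ∋⟨ k , w ⟩
  ∪⁻ (graph X x v) (graph Y y w) (inj₁ i , e) = inj₁ (i , e)
  ∪⁻ (graph X x v) (graph Y y w) (inj₂ j , e) = inj₂ (j , e)

  ∪⁺ˡ : ∀ {γ} (G H : Graph γ) {k w} → G ∋⟨ k , w ⟩ → (G ∪ H) ∋⟨ k , w ⟩
  ∪⁺ˡ (graph X x v) (graph Y y w) (i , e) = inj₁ i , e

  ∪⁺ʳ : ∀ {γ} (G H : Graph γ) {k w} → H ∋⟨ k , w ⟩ → (G ∪ H) ∋⟨ k , w ⟩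
  ∪⁺ʳ (graph X x v) (graph Y y w) (j , e) = inj₂ j , e

  Index : ∀ {γ} → Graph γ → Set (lsuc ℓ)
  Index (graph X _ _) = X

  key : ∀ {γ} (G : Graph γ) → Index G → Arg γ
  key (graph _ x _) = x

  val : ∀ {γ} (G : Graph γ) → Index G → ∣Ω∣
  val (graph _ _ v) = v

  -- The index family of ⋃ G is a local function of the definition of ⋃, and
  -- can only be named by unification.
  Fibre : ∀ {γ} {A : Set ℓ} (G : A → Graph γ) →
          Σ[ B ∈ (A → Set (lsuc ℓ)) ] Index (⋃ G) ≡ Σ A B
  Fibre G = _ , ≡.refl

  ⋃⁻ : ∀ {γ} {A : Set ℓ} (G : A → Graph γ) {k w} →
       ⋃ G ∋⟨ k , w ⟩ → Σ[ i ∈ A ] G i ∋⟨ k , w ⟩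
  ⋃⁻ G {k} {w} ((i , j) , k≈ , v≈) = i , member j k≈ v≈
    where
    member : (j : proj₁ (Fibre G) i) → key (⋃ G) (i , j) ≈Arg k → val (⋃ G) (i , j) ≈Ω w →
             G i ∋⟨ k , w ⟩
    -- The local functions of `⋃` compute only once `G i` is matched against its constructor.
    member j k≈ v≈ with graph X x v ← G i = j , k≈ , v≈

  ⋃⁺ : ∀ {γ} {A : Set ℓ} (G : A → Graph γ) i {k w} → G i ∋⟨ k , w ⟩ → ⋃ G ∋⟨ k , w ⟩
  ⋃⁺ G i {k} {w} e = (i , proj₁ (member e)) , proj₂ (member e)
    where
    member : G i ∋⟨ k , w ⟩ →
             Σ[ j ∈ proj₁ (Fibre G) i ] (key (⋃ G) (i , j) ≈Arg k × val (⋃ G) (i , j) ≈Ω w)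
    member e with graph _ _ _ ← G i = e

  -- Unfolding the transfinite recursion.

  _◁_ : Ord ℓ → Ord ℓ → Set (lsuc ℓ)
  β ◁ zeroᵒ      = ⊥
  β ◁ sucᵒ α     = β ≡ α ⊎ β ◁ α
  β ◁ limᵒ A _ α = Σ[ i ∈ A ] β ◁ α i

  -- `β ◁ α` says that the successor step at `β` is passed in the recursion reaching `α`. Induction
  -- along it handles zero, successors and limits at once.
  ◁-wellFounded : WellFounded _◁_
  ◁-wellFounded α = acc (below α)
    where
    below : ∀ α {β} → β ◁ α → Acc _◁_ β
    below (sucᵒ α)     (inj₁ ≡.refl)  = acc (below α)
    below (sucᵒ α)     (inj₂ β◁α)     = below α β◁α
    below (limᵒ A _ α) (i , β◁αi)     = below (α i) β◁αi

  module _ (β : Ord ℓ) (M : Structure) {γ : Set ℓ} (a : Tuple M γ) where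

    -- Copies of the local functions in the successor clause of `F`, which is thereby definitionally
    -- `F β M a ∪ Stage β M a`.
    argument : NewArg γ (E a) → Arg γ
    argument x = stage m (F β K st) β
      where open NewArg x

    Matching : NewArg γ (E a) → Set (lsuc ℓ)
    Matching x = Σ[ c ∈ Tuple M (↓ m) ] Σ[ c≤t ∈ E c ≤ E t ]
      F β K (st ↾ E c) ≈G F β M (concat a c (Ω.trans c≤t t≤e))
      where open NewArg x

    value : NewArg γ (E a) → ∣Ω∣
    value x = Ω.⋁ {Matching x} (λ (c , _) → E c)

    Stage : Graph γ
    Stage = graph (NewArg γ (E a)) argument value

  F⁻ : ∀ α M {γ} (a : Tuple M γ) {k w} → F α M a ∋⟨ k , w ⟩ →
       I M a ∋⟨ k , w ⟩ ⊎ Σ[ β ∈ Ord ℓ ] (β ◁ α × Stage β M a ∋⟨ k , w ⟩)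
  F⁻ zeroᵒ        M a e = inj₁ e
  F⁻ (sucᵒ α)     M a e with ∪⁻ (F α M a) (Stage α M a) e
  ... | inj₂ e′ = inj₂ (α , inj₁ ≡.refl , e′)
  ... | inj₁ e′ with F⁻ α M a e′
  ...   | inj₁ e″              = inj₁ e″
  ...   | inj₂ (β , β◁α , e″) = inj₂ (β , inj₂ β◁α , e″)
  F⁻ (limᵒ A _ α) M a e with ⋃⁻ (λ i → F (α i) M a) e
  ... | i , e′ with F⁻ (α i) M a e′
  ...   | inj₁ e″               = inj₁ e″
  ...   | inj₂ (β , β◁αi , e″) = inj₂ (β , (i , β◁αi) , e″)

  F⁺-I : ∀ α M {γ} (a : Tuple M γ) {k w} → I M a ∋⟨ k , w ⟩ → F α M a ∋⟨ k , w ⟩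
  F⁺-I zeroᵒ         M a e = e
  F⁺-I (sucᵒ α)      M a e = ∪⁺ˡ (F α M a) (Stage α M a) (F⁺-I α M a e)
  -- An empty union would lose `I`; the limit family provides the index `i₀`.
  F⁺-I (limᵒ A i₀ α) M a e = ⋃⁺ (λ i → F (α i) M a) i₀ (F⁺-I (α i₀) M a e)

  F⁺-Stage : ∀ α M {γ} (a : Tuple M γ) {β k w} → β ◁ α →
             Stage β M a ∋⟨ k , w ⟩ → F α M a ∋⟨ k , w ⟩
  F⁺-Stage (sucᵒ α)     M a (inj₁ ≡.refl) e = ∪⁺ʳ (F α M a) (Stage α M a) e
  F⁺-Stage (sucᵒ α)     M a (inj₂ β◁α)    e =
    ∪⁺ˡ (F α M a) (Stage α M a) (F⁺-Stage α M a β◁α e)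
  F⁺-Stage (limᵒ A _ α) M a (i , β◁αi)    e =
    ⋃⁺ (λ i → F (α i) M a) i (F⁺-Stage (α i) M a β◁αi e)

  infix 4 _∼⟨_⟩_

  -- A record because `≈G` computes on graphs, from which the tuples could not be inferred.
  record _∼⟨_⟩_ {M N : Structure} {γ : Set ℓ} (a : Tuple M γ) (α : Ord ℓ) (b : Tuple N γ) :
                Set (lsuc ℓ) where
    constructor ∼-intro
    field graphs : F α M a ≈G F α N b

  open _∼⟨_⟩_

  ∼-sym : ∀ {α M N γ} {a : Tuple M γ} {b : Tuple N γ} → a ∼⟨ α ⟩ b → b ∼⟨ α ⟩ a
  ∼-sym {α} {M} {N} {a = a} {b} (∼-intro e) = ∼-intro (≈G-sym (F α M a) (F α N b) e)

  ∼-trans : ∀ {α M N K γ} {a : Tuple M γ} {b : Tuple N γ} {c : Tuple K γ} →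
            a ∼⟨ α ⟩ b → b ∼⟨ α ⟩ c → a ∼⟨ α ⟩ c
  ∼-trans {α} {M} {N} {K} {a = a} {b} {c} (∼-intro e) (∼-intro e′) =
    ∼-intro (≈G-trans (F α M a) (F α N b) (F α K c) e e′)

  module _ {M N : Structure} {γ : Set ℓ} {a : Tuple M γ} {b : Tuple N γ} where

    SameType⇒I⊆ : SameType a b → ∀ {k w} → I M a ∋⟨ k , w ⟩ → I N b ∋⟨ k , w ⟩
    SameType⇒I⊆ s (lift (arg₀ ψ exact f) , k≈ , v≈) =
      lift (arg₀ ψ exact f) , k≈ ,
      Ω.Eq.trans (Ω.Eq.sym (SameType.exact-same s ψ exact f)) v≈

    ∼⇒SameType : ∀ {α} → a ∼⟨ α ⟩ b → SameType a b
    ∼⇒SameType {α} (∼-intro e) = record { exact-same = exact-same }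
      where
      module Mₚ = Interpretation M
      module Nₚ = Interpretation N
      exact-same : ∀ {n} (ψ : Unnested n) → (∀ i → i ∈ variables ψ) → (f : Fin′ Ω n → γ) →
                   ⟦ M ⟧ψ ψ (at a ∘ f) ≈Ω ⟦ N ⟧ψ ψ (at b ∘ f)
      exact-same ψ exact f
        with F⁻ α N b {base (arg₀ ψ exact f)} (≈G⇒⊆ (F α M a) (F α N b) e (F⁺-I α M a
               (lift (arg₀ ψ exact f) , lift (≈Arg₀-refl _) , Ω.Eq.refl)))
      -- A `base` argument can only come from `I`. The formula found there may present its constants
      -- differently, and its assignment agrees only pointwise.
      ... | inj₁ (lift (arg₀ χ _ g) , lift (same χ≈ψ g≡f) , v≈) = Ω.Eq.trans (Ω.Eq.sym v≈)
        (Ω.Eq.trans (Nₚ.ψ-cong χ (Structure.reflexive N ∘ ≡.cong (at b) ∘ g≡f))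
                    (Nₚ.ψ-resp-≈ψ χ≈ψ _))

    -- The tag `β` inside a new argument singles out the layer to which it belongs.
    ∼⇒Stage⊆ : ∀ {α β} → a ∼⟨ α ⟩ b → β ◁ α → ∀ {k w} →
               Stage β M a ∋⟨ k , w ⟩ → Stage β N b ∋⟨ k , w ⟩
    ∼⇒Stage⊆ {α} (∼-intro e) β◁α {stage _ _ _} (x , k≈@(_ , ≡.refl) , v≈)
      with F⁻ α N b (≈G⇒⊆ (F α M a) (F α N b) e (F⁺-Stage α M a β◁α (x , k≈ , v≈)))
    ... | inj₂ (_ , _ , (y , (H≈ , ≡.refl) , v≈′)) = y , (H≈ , ≡.refl) , v≈′

  ∼⇒Stage≈ : ∀ {M N γ} {a : Tuple M γ} {b : Tuple N γ} {α β} →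
             a ∼⟨ α ⟩ b → β ◁ α → Stage β M a ≈G Stage β N b
  ∼⇒Stage≈ a∼b β◁α = ⊆-antisym (Stage _ _ _) (Stage _ _ _)
    (∼⇒Stage⊆ a∼b β◁α) (∼⇒Stage⊆ (∼-sym a∼b) β◁α)

  stages⇒∼ : ∀ {α M N γ} {a : Tuple M γ} {b : Tuple N γ} → SameType a b →
             (∀ {β} → β ◁ α → Stage β M a ≈G Stage β N b) → a ∼⟨ α ⟩ b
  stages⇒∼ {α} {M} {N} {a = a} {b} s stages = ∼-intro (⊆-antisym (F α M a) (F α N b)
    (F⊆ s stages)
    (F⊆ (SameType-sym s) (λ β◁α → ≈G-sym (Stage _ M a) (Stage _ N b) (stages β◁α))))
    where
    F⊆ : ∀ {M N γ} {a : Tuple M γ} {b : Tuple N γ} → SameType a b →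
         (∀ {β} → β ◁ α → Stage β M a ≈G Stage β N b) →
         ∀ {k w} → F α M a ∋⟨ k , w ⟩ → F α N b ∋⟨ k , w ⟩
    F⊆ {M} {N} {a = a} {b} s stages e with F⁻ α M a e
    ... | inj₁ e′              = F⁺-I α N b (SameType⇒I⊆ s e′)
    ... | inj₂ (β , β◁α , e′) =
      F⁺-Stage α N b β◁α (≈G⇒⊆ (Stage β M a) (Stage β N b) (stages β◁α) e′)

  -- Extents of tuples and concatenations.

  E-at : ∀ {M γ} (a : Tuple M γ) i → Structure.E M (at a i) ≈Ω E a
  E-at a i = Ω.antisym (Ω.⋀-greatest _ _ (λ j → Ω.reflexive (uniform a i j))) (Ω.⋀-lower _ i)

  ≤E-↾ : ∀ {M γ} (a : Tuple M γ) {q} → q ≤ E a → q ≤ E (a ↾ q)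
  ≤E-↾ {M} a q≤E = Ω.⋀-greatest _ _ (λ i → Ω.trans
    (Ω.∧-greatest (Ω.trans q≤E (Ω.⋀-lower _ i)) Ω.refl)
    (Ω.reflexive (Ω.Eq.sym (Structure.E-↾ M _ _))))

  -- The index excludes the empty tuple, whose extent is `𝟙` whatever `q` is.
  E-↾≤ : ∀ {M γ} (a : Tuple M γ) q → γ → E (a ↾ q) ≤ q
  E-↾≤ {M} a q i = Ω.trans (Ω.⋀-lower _ i)
    (Ω.trans (Ω.reflexive (Structure.E-↾ M _ _)) (Ω.x∧y≤y _ _))

  E-↾≤E : ∀ {M γ} (a : Tuple M γ) q → E (a ↾ q) ≤ E a
  E-↾≤E {M} a q = Ω.⋀-greatest _ _ (λ i → Ω.trans (Ω.⋀-lower _ i)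
    (Ω.trans (Ω.reflexive (Structure.E-↾ M _ _)) (Ω.x∧y≤x _ _)))

  E-concat : ∀ {M γ δ} (a : Tuple M γ) (c : Tuple M δ) c≤a → E (concat a c c≤a) ≈Ω E c
  E-concat {M} a c c≤a = Ω.antisym
    (Ω.⋀-greatest _ _ (λ j → Ω.⋀-lower _ (inj₂ j)))
    (Ω.⋀-greatest _ _ λ
      { (inj₁ i) → Ω.trans (Ω.∧-greatest (Ω.trans c≤a (Ω.⋀-lower _ i)) Ω.refl)
                           (Ω.reflexive (Ω.Eq.sym (Structure.E-↾ M _ _)))
      ; (inj₂ j) → Ω.⋀-lower _ j })

  E-st : ∀ {γ e} (x : NewArg γ e) → E (NewArg.st x) ≈Ω E (NewArg.t x)
  E-st x = E-concat s t (Ω.trans bound (Ω.x∧y≤y _ _))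
    where open NewArg x

  infix 4 _≋_

  _≋_ : ∀ {M γ} → Tuple M γ → Tuple M γ → Set ℓ
  _≋_ {M} a b = ∀ i → Structure._≈_ M (at a i) (at b i)

  concat-congˡ : ∀ {M γ δ} {a a′ : Tuple M γ} → a ≋ a′ → ∀ (c : Tuple M δ) c≤a c≤a′ →
                 concat a c c≤a ≋ concat a′ c c≤a′
  concat-congˡ {M} a≋ c _ _ (inj₁ i) = Structure.↾-cong M (a≋ i) Ω.Eq.refl
  concat-congˡ {M} a≋ c _ _ (inj₂ j) = Structure.refl M

  SameType-cong : ∀ {M γ} {a a′ : Tuple M γ} → a ≋ a′ → SameType a a′
  SameType-cong {M} a≋ = record
    { exact-same = λ ψ _ f → Interpretation.ψ-cong M ψ (λ k → a≋ (f k)) }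

  SameType-↾ : ∀ {M N γ} {a : Tuple M γ} {b : Tuple N γ} → SameType a b →
               ∀ q → SameType (a ↾ q) (b ↾ q)
  SameType-↾ {M} {N} s q = record { exact-same = λ ψ exact f →
    Ω.Eq.trans (Interpretation.ψ-↾ M ψ _ (λ _ → q))
      (Ω.Eq.trans (∧-cong (SameType.exact-same s ψ exact f) Ω.Eq.refl)
                  (Ω.Eq.sym (Interpretation.ψ-↾ N ψ _ (λ _ → q)))) }

  SameType⇒E : ∀ {M N γ} {a : Tuple M γ} {b : Tuple N γ} → SameType a b → E a ≈Ω E b
  SameType⇒E s = ⋀-cong (SameType.E-same s)

  -- `E a` and `E b` are equivalent at best, not definitionally equal, so triples have to be moved
  -- between the types that they index. The sections of `st` are unchanged; only proofs differ.
  rebase : ∀ {γ e e′} (x : NewArg γ e) → E (NewArg.t x) ≤ e′ ∧ E (NewArg.s x) → NewArg γ e′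
  rebase x bound = record
    { K = K ; s = s ; m = m ; t = t ; nonempty = nonempty ; bound = bound }
    where open NewArg x using (K; s; m; t; nonempty)

  module _ {β : Ord ℓ} {M : Structure} {γ : Set ℓ} {a : Tuple M γ} (x : NewArg γ (E a)) where
    open NewArg x

    value-least : ∀ {w} →
      (∀ c (c≤t : E c ≤ E t) → (st ↾ E c) ∼⟨ β ⟩ concat a c (Ω.trans c≤t t≤e) → E c ≤ w) →
      value β M a x ≤ w
    value-least h = Ω.⋁-least _ _ (λ (c , c≤t , e) → h c c≤t (∼-intro e))

    value-upper : ∀ c (c≤t : E c ≤ E t) → (st ↾ E c) ∼⟨ β ⟩ concat a c (Ω.trans c≤t t≤e) →
                  E c ≤ value β M a x
    value-upper c c≤t (∼-intro e) = Ω.⋁-upper _ (c , c≤t , e)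

  -- Invariance under equality of sections and under restriction.

  Congruent : Pred (Ord ℓ) (lsuc ℓ)
  Congruent α = ∀ {M γ} {a a′ : Tuple M γ} → a ≋ a′ → a ∼⟨ α ⟩ a′

  -- The two tuples `st` have the same sections but different proofs of uniformity, hence the appeal
  -- to `Congruent`.
  argument-rebase : ∀ {β} → Congruent β → ∀ {M N γ} {a : Tuple M γ} {b : Tuple N γ}
                    (x : NewArg γ (E a)) bound →
                    argument β M a x ≈Arg argument β N b (rebase x bound)
  argument-rebase cong x bound =
    (≡.refl , graphs (cong (λ _ → Structure.refl (NewArg.K x)))) , ≡.refl

  stage-intro : ∀ {β} → Congruent β → ∀ {M N γ} {a : Tuple M γ} {b : Tuple N γ} →
                E a ≈Ω E b →
                (∀ x bound → value β M a x ≈Ω value β N b (rebase x bound)) →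
                Stage β M a ≈G Stage β N b
  stage-intro {β} cong {M} {N} {a = a} {b} Ea≈Eb value≈ =
    (λ x → let x≤b = Ω.trans (NewArg.bound x) (∧-monotonicˡ (Ω.reflexive Ea≈Eb)) in
      rebase x x≤b , argument-rebase cong {a = a} {b} x x≤b , value≈ x x≤b) ,
    (λ y → let y≤a = Ω.trans (NewArg.bound y)
                       (∧-monotonicˡ (Ω.reflexive (Ω.Eq.sym Ea≈Eb))) in
      rebase y y≤a ,
      ≈Arg-sym (argument β N b y) (argument β M a (rebase y y≤a))
        (argument-rebase cong {a = b} {a} y y≤a) ,
      -- Rebasing there and back gives `y` again, by eta.
      value≈ (rebase y y≤a) (NewArg.bound y))

  value-mono : ∀ {β} → Congruent β → ∀ {M γ} {a a′ : Tuple M γ} → a ≋ a′ →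
               (x : NewArg γ (E a)) (x≤a′ : E (NewArg.t x) ≤ E a′ ∧ E (NewArg.s x)) →
               value β M a x ≤ value β M a′ (rebase x x≤a′)
  value-mono cong {M} {a = a} {a′} a≋ x x≤a′ = value-least x λ c c≤t st∼ac →
    value-upper (rebase x x≤a′) c c≤t
      (∼-trans (cong (λ _ → Structure.refl (NewArg.K x)))
        (∼-trans st∼ac (cong (concat-congˡ {a = a} {a′} a≋ c
          (Ω.trans c≤t (NewArg.t≤e x)) (Ω.trans c≤t (NewArg.t≤e (rebase x x≤a′)))))))

  congruent : ∀ α → Congruent α
  congruent = All.wfRec ◁-wellFounded _ Congruent λ α cong {M} {a = a} {a′} a≋ →
    let s = SameType-cong {a = a} {a′} a≋ in
    stages⇒∼ s λ β◁α → stage-intro (cong β◁α) (SameType⇒E s) λ x x≤a′ →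
    Ω.antisym (value-mono (cong β◁α) a≋ x x≤a′)
              (value-mono (cong β◁α) (λ i → Structure.sym M (a≋ i)) (rebase x x≤a′) (NewArg.bound x))

  ∼-cong : ∀ {α M γ} {a a′ : Tuple M γ} → a ≋ a′ → a ∼⟨ α ⟩ a′
  ∼-cong = congruent _

  Restrictive : Pred (Ord ℓ) (lsuc ℓ)
  Restrictive α = ∀ {M N γ} {a : Tuple M γ} {b : Tuple N γ} →
                  a ∼⟨ α ⟩ b → ∀ q → (a ↾ q) ∼⟨ α ⟩ (b ↾ q)

  -- Well-definedness of values: if the tuples `st` of `x` and `y` are equivalent, so are their
  -- restrictions to `E c`, and `c` contributes to both suprema. Their extents agree because extents
  -- are values of equations.
  value-resp-≤ : ∀ {β} → Restrictive β → ∀ {M γ} {a : Tuple M γ} (x y : NewArg γ (E a)) →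
                 argument β M a x ≈Arg argument β M a y → value β M a x ≤ value β M a y
  value-resp-≤ {β} restr {M} x@record { m = m } y ((≡.refl , e) , _) =
    value-least x λ c c≤t st∼ac → value-upper y c
      (Ω.trans c≤t (Ω.reflexive (Ω.Eq.trans (Ω.Eq.sym (E-st x))
        (Ω.Eq.trans (SameType⇒E (∼⇒SameType st∼st)) (E-st y)))))
      (∼-trans (restr (∼-sym st∼st) (E c))
        (∼-trans st∼ac (∼-cong (λ _ → Structure.refl M))))
    where
    st∼st : NewArg.st x ∼⟨ β ⟩ NewArg.st y
    st∼st = ∼-intro e

  value-resp : ∀ {β} → Restrictive β → ∀ {M γ} {a : Tuple M γ} (x y : NewArg γ (E a)) →
               argument β M a x ≈Arg argument β M a y → value β M a x ≈Ω value β M a y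
  value-resp {β} restr {M} {a = a} x y x≈y = Ω.antisym (value-resp-≤ restr x y x≈y)
    (value-resp-≤ restr y x (≈Arg-sym (argument β M a x) (argument β M a y) x≈y))

  -- Equality of graphs only yields some `y` with the same argument as `x`; well-definedness leads
  -- from `y` to `rebase x bound`.
  stage-elim : ∀ {β} → Restrictive β → ∀ {M N γ} {a : Tuple M γ} {b : Tuple N γ} →
               Stage β M a ≈G Stage β N b →
               ∀ x bound → value β M a x ≈Ω value β N b (rebase x bound)
  stage-elim {β} restr {M} {N} {a = a} {b} (Ma⊆Nb , _) x bound =
    let (y , x≈y , v≈) = Ma⊆Nb x in
    Ω.Eq.trans v≈ (value-resp restr y (rebase x bound)
      (≈Arg-trans (argument β N b y) (argument β M a x) (argument β N b (rebase x bound))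
        (≈Arg-sym (argument β M a x) (argument β N b y) x≈y)
        (argument-rebase (congruent β) {a = a} {b} x bound)))

  -- Contributing tuples have extent at most `E t`, which is below `q` as soon as `a` has an entry;
  -- cutting `a` to `q` before cutting it to `E c` changes nothing.
  value-↾ : ∀ β {M γ} {a : Tuple M γ} {q} (x : NewArg γ (E (a ↾ q))) x≤a →
            value β M (a ↾ q) x ≈Ω value β M a (rebase x x≤a)
  value-↾ β {M} {a = a} {q} x x≤a = Ω.antisym
    (value-least x λ c c≤t st∼ac → value-upper (rebase x x≤a) c c≤t
      (∼-trans (∼-sym (st∼st (E c))) (∼-trans st∼ac (∼-cong (≋ c c≤t)))))
    (value-least (rebase x x≤a) λ c c≤t st∼ac → value-upper x c c≤t
      (∼-trans (st∼st (E c)) (∼-trans st∼ac (∼-cong (λ i → Structure.sym M (≋ c c≤t i))))))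
    where
    open NewArg x using (K; t; t≤e; m)
    module Mₚ = Interpretation M
    st∼st : ∀ r → (NewArg.st x ↾ r) ∼⟨ β ⟩ (NewArg.st (rebase x x≤a) ↾ r)
    st∼st r = ∼-cong (λ _ → Structure.refl K)
    ≋ : ∀ c (c≤t : E c ≤ E t) →
        concat (a ↾ q) c (Ω.trans c≤t t≤e) ≋ concat a c (Ω.trans c≤t (NewArg.t≤e (rebase x x≤a)))
    ≋ c c≤t (inj₁ i) = Mₚ.↾-↾-≤ (Ω.trans (Ω.trans c≤t t≤e) (E-↾≤ a q i))
    ≋ c c≤t (inj₂ j) = Structure.refl M

  -- By `value-↾` the values for the restricted tuples are values for `a` and `b` themselves. The
  -- induction hypothesis enters through the well-definedness used in `stage-elim`.
  restrictive : ∀ α → Restrictive α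
  restrictive = All.wfRec ◁-wellFounded _ Restrictive λ α restr {a = a} {b} a∼b q →
    let s = SameType-↾ (∼⇒SameType a∼b) q in
    stages⇒∼ s λ {β} β◁α → stage-intro (congruent β) (SameType⇒E s) λ x x≤b →
    let x≤a = Ω.trans (NewArg.bound x) (∧-monotonicˡ (E-↾≤E a q))
        x≤b′ = Ω.trans x≤b (∧-monotonicˡ (E-↾≤E b q)) in
    Ω.Eq.trans (value-↾ β x x≤a)
      (Ω.Eq.trans (stage-elim (restr β◁α) (∼⇒Stage≈ a∼b β◁α) (rebase x x≤a) x≤b′)
                  (Ω.Eq.sym (value-↾ β (rebase x x≤b) x≤b′)))

  ∼-↾ : ∀ {α M N γ} {a : Tuple M γ} {b : Tuple N γ} →
        a ∼⟨ α ⟩ b → ∀ q → (a ↾ q) ∼⟨ α ⟩ (b ↾ q)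
  ∼-↾ = restrictive _

  -- Unfolding `Q`, and maps at a fixed extent.

  Q⁺ : ∀ α {p M N} (h : PartialIso M N) →
       (∀ {β} → β ◁ α → Forth h p (λ q k → Q β q k) × Back h p (λ q k → Q β q k)) →
       Q α p h
  Q⁺ zeroᵒ        h bf = tt
  Q⁺ (sucᵒ α)     h bf = Q⁺ α h (bf ∘ inj₂) , bf (inj₁ ≡.refl)
  Q⁺ (limᵒ A _ α) h bf = λ i → Q⁺ (α i) h (λ β◁αi → bf (i , β◁αi))

  Q⁻ : ∀ α {p M N} (h : PartialIso M N) → Q α p h → ∀ {β} → β ◁ α →
       Forth h p (λ q k → Q β q k) × Back h p (λ q k → Q β q k)
  Q⁻ (sucᵒ α)     h (_ , bf) (inj₁ ≡.refl) = bf
  Q⁻ (sucᵒ α)     h (Qh , _) (inj₂ β◁α)    = Q⁻ α h Qh β◁α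
  Q⁻ (limᵒ A _ α) h Qh       (i , β◁αi)    = Q⁻ (α i) h (Qh i) β◁αi

  ↦-resp : ∀ {M N} (h : PartialIso M N) {x x′ y y′} → Structure._≈_ M x x′ →
           Structure._≈_ N y y′ → x ⟨ h ⟩↦ y → x′ ⟨ h ⟩↦ y′
  ↦-resp {M} {N} h x≈ y≈ ((a , p , eq) , eq′) =
    (a , p , Structure.trans M (Structure.sym M x≈) eq) , Structure.trans N eq′ y≈

  ↦-↾ : ∀ {M N} (h : PartialIso M N) {x y} → x ⟨ h ⟩↦ y → ∀ q →
        Structure._↾_ M x q ⟨ h ⟩↦ Structure._↾_ N y q
  ↦-↾ {M} {N} h ((a , p , eq) , eq′) q =
    (a , p ∧ q , M.trans (M.↾-cong eq Ω.Eq.refl) (M.↾-↾ _ _ _)) ,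
    N.trans (N.sym (N.↾-↾ _ _ _)) (N.↾-cong eq′ Ω.Eq.refl)
    where
    module M = Structure M
    module N = Structure N

  ⊆⇒↦ : ∀ {M N q} (h k : PartialIso M N) → RestrictionAt q Of h ⊆ k →
        ∀ {x y} → Structure.E M x ≈Ω q → x ⟨ h ⟩↦ y → x ⟨ k ⟩↦ y
  ⊆⇒↦ {N = N} h k h⊆k Ex≈q (x∈ , eq) =
    let (x∈′ , eq′) = h⊆k _ x∈ Ex≈q in x∈′ , Structure.trans N eq′ eq

  -- A section of extent `q` in the domain is some `at a i` cut to `q`, whatever exponent presents
  -- it, and its image is `at b i` cut to `q`.
  tupleIso-⊆ : ∀ {M N γ} {a : Tuple M γ} {b : Tuple N γ} (s : SameType a b)
               (k : PartialIso M N) {q} →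
               (∀ i → Structure._↾_ M (at a i) q ⟨ k ⟩↦ Structure._↾_ N (at b i) q) →
               RestrictionAt q Of tupleIso a b s ⊆ k
  tupleIso-⊆ {M} {N} {a = a} {b} s k {q} maps x ((_ , i , a′≈) , r , x≈) Ex≈q =
    ↦-resp k (M.sym (Mₚ.↾-extent x≈′ Ex≈q)) (N.sym (Nₚ.↾-extent N.refl extent)) (maps i)
    where
    module M = Structure M
    module N = Structure N
    module Mₚ = Interpretation M
    module Nₚ = Interpretation N
    x≈′ : x M.≈ at a i M.↾ r
    x≈′ = M.trans x≈ (M.↾-cong a′≈ Ω.Eq.refl)
    extent : N.E (at b i N.↾ r) ≈Ω q
    extent = begin
      N.E (at b i N.↾ r) ≈⟨ N.E-↾ _ _ ⟩
      N.E (at b i) ∧ r   ≈⟨ ∧-cong (SameType.E-same s i) Ω.Eq.refl ⟨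
      M.E (at a i) ∧ r   ≈⟨ M.E-↾ _ _ ⟨
      M.E (at a i M.↾ r) ≈⟨ M.E-cong x≈′ ⟨
      M.E x              ≈⟨ Ex≈q ⟩
      q                  ∎
      where open import Relation.Binary.Reasoning.Setoid Ω.setoid

  -- From equal functions to membership in `Q`.

  module _ {M : Structure} {γ : Set ℓ} (a : Tuple M γ) (m : ∣μ∣) (nonempty : ↓ m)
           (c : Tuple M (↓ m)) (c≤a : E c ≤ E a) where

    selfArg : ∀ {e} → E c ≤ e → NewArg γ e
    selfArg c≤e = record
      { K = M ; s = a ; m = m ; t = c ; nonempty = nonempty ; bound = Ω.∧-greatest c≤e c≤a }

    -- No contribution exceeds `E c`, and `c` itself contributes it.
    value-selfArg : ∀ β → value β M a (selfArg c≤a) ≈Ω E c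
    value-selfArg β = Ω.antisym
      (value-least {β} {a = a} (selfArg c≤a) (λ _ c′≤c _ → c′≤c))
      (value-upper {β} {a = a} (selfArg c≤a) c Ω.refl (∼-cong λ
        { (inj₁ i) → Interpretation.↾-absorb M (Ω.trans (Ω.reflexive (Structure.E-↾ M _ _)) (Ω.x∧y≤y _ _))
        ; (inj₂ j) → Interpretation.↾-absorb M (Ω.reflexive (E-at c j)) }))

    value-selfArg-∼ : ∀ {α β N} {b : Tuple N γ} → a ∼⟨ α ⟩ b → β ◁ α → (c≤b : E c ≤ E b) →
                      value β N b (selfArg c≤b) ≈Ω E c
    value-selfArg-∼ {β = β} a∼b β◁α c≤b = Ω.Eq.trans
      (Ω.Eq.sym (stage-elim (restrictive β) (∼⇒Stage≈ a∼b β◁α) (selfArg c≤a) (Ω.∧-greatest c≤b c≤a)))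
      (value-selfArg β)

  E≤-nonempty : ∀ {M δ p} (c : Tuple M δ) → δ → (∀ i → Structure.E M (at c i) ≤ p) → E c ≤ p
  E≤-nonempty c i c≤p = Ω.trans (Ω.⋀-lower _ i) (c≤p i)

  -- The isomorphism is fixed as `tupleIso`, so that the induction hypothesis applies to the maps
  -- offered as answers. The bounds on `p` let every tuple below `p` be concatenated with `a` and
  -- with `b`.
  Realised : Pred (Ord ℓ) (lsuc (lsuc ℓ))
  Realised α = ∀ {M N γ} {a : Tuple M γ} {b : Tuple N γ} {p} → p ≤ E a → p ≤ E b →
               a ∼⟨ α ⟩ b → (s : SameType a b) → Q α p (tupleIso a b s)

  realised : ∀ α → Realised α
  realised = All.wfRec ◁-wellFounded _ Realised step
    where
    step : ∀ α → (∀ {β} → β ◁ α → Realised β) → Realised α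
    step α ih {M} {N} {γ} {a} {b} {p} p≤a p≤b a∼b s =
      Q⁺ α (tupleIso a b s) (λ β◁α → forth β◁α , back β◁α)
      where
      module M = Structure M
      module N = Structure N
      module Mₚ = Interpretation M
      module Nₚ = Interpretation N

      forth : ∀ {β} → β ◁ α → Forth (tupleIso a b s) p (λ q k → Q β q k)
      forth {β} β◁α m i₀ c c≤p =
        -- The answers are the tuples in the supremum defining the value for `b`; that this value is
        -- `E c` is the covering condition.
        Matching β N b x , k , (λ (d , _) → E d) , proj₁ , properties ,
        value-selfArg-∼ a m i₀ c c≤a a∼b β◁α c≤b
        where
        c≤a : E c ≤ E a
        c≤a = Ω.trans (E≤-nonempty c i₀ c≤p) p≤a
        c≤b : E c ≤ E b
        c≤b = Ω.trans (E≤-nonempty c i₀ c≤p) p≤b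
        x : NewArg γ (E b)
        x = selfArg a m i₀ c c≤a c≤b
        module _ (j : Matching β N b x) where
          d : Tuple N (↓ m)
          d = proj₁ j
          d≤c : E d ≤ E c
          d≤c = proj₁ (proj₂ j)
          d≤b : E d ≤ E b
          d≤b = Ω.trans d≤c (NewArg.t≤e x)
          ac∼bd : (NewArg.st x ↾ E d) ∼⟨ β ⟩ concat b d d≤b
          ac∼bd = ∼-intro (proj₂ (proj₂ j))
          same-type : SameType (NewArg.st x ↾ E d) (concat b d d≤b)
          same-type = ∼⇒SameType ac∼bd
          k : PartialIso M N
          k = tupleIso (NewArg.st x ↾ E d) (concat b d d≤b) same-type
          maps : ∀ i → at (NewArg.st x ↾ E d) i ⟨ k ⟩↦ at (concat b d d≤b) i
          maps = tupleIso-maps (NewArg.st x ↾ E d) (concat b d d≤b) same-type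
          properties : Q β (E d) k × RestrictionAt (E d) Of tupleIso a b s ⊆ k
            × (∀ i → N.E (at d i) ≤ E c) × E d ≈Ω E d
            × (∀ i → (at c i M.↾ E d) ⟨ k ⟩↦ at d i)
          properties =
            ih β◁α
              (≤E-↾ (NewArg.st x) (Ω.trans d≤c (Ω.reflexive (Ω.Eq.sym (E-st x)))))
              (Ω.reflexive (Ω.Eq.sym (E-concat b d d≤b))) ac∼bd same-type ,
            tupleIso-⊆ s k (λ i → ↦-resp k (Mₚ.↾-↾-≤ d≤c) N.refl (maps (inj₁ i))) ,
            (λ i → Ω.trans (Ω.reflexive (E-at d i)) d≤c) ,
            Ω.Eq.refl ,
            (λ i → maps (inj₂ i))

      back : ∀ {β} → β ◁ α → Back (tupleIso a b s) p (λ q k → Q β q k)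
      back {β} β◁α m i₀ d d≤p =
        Matching β M a x , k , (λ (c , _) → E c) , proj₁ , properties ,
        value-selfArg-∼ b m i₀ d d≤b (∼-sym a∼b) β◁α d≤a
        where
        d≤a : E d ≤ E a
        d≤a = Ω.trans (E≤-nonempty d i₀ d≤p) p≤a
        d≤b : E d ≤ E b
        d≤b = Ω.trans (E≤-nonempty d i₀ d≤p) p≤b
        x : NewArg γ (E a)
        x = selfArg b m i₀ d d≤b d≤a
        module _ (j : Matching β M a x) where
          c : Tuple M (↓ m)
          c = proj₁ j
          c≤d : E c ≤ E d
          c≤d = proj₁ (proj₂ j)
          c≤a : E c ≤ E a
          c≤a = Ω.trans c≤d (NewArg.t≤e x)
          ac∼bd : concat a c c≤a ∼⟨ β ⟩ (NewArg.st x ↾ E c)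
          -- The argument comes from `N` here while the maps still start from `M`, so the
          -- equivalence is reversed.
          ac∼bd = ∼-sym (∼-intro (proj₂ (proj₂ j)))
          same-type : SameType (concat a c c≤a) (NewArg.st x ↾ E c)
          same-type = ∼⇒SameType ac∼bd
          k : PartialIso M N
          k = tupleIso (concat a c c≤a) (NewArg.st x ↾ E c) same-type
          maps : ∀ i → at (concat a c c≤a) i ⟨ k ⟩↦ at (NewArg.st x ↾ E c) i
          maps = tupleIso-maps (concat a c c≤a) (NewArg.st x ↾ E c) same-type
          properties : Q β (E c) k × RestrictionAt (E c) Of tupleIso a b s ⊆ k
            × (∀ i → M.E (at c i) ≤ E d) × E c ≈Ω E c
            × (∀ i → at c i ⟨ k ⟩↦ (at d i N.↾ E c))
          properties =
            ih β◁α (Ω.reflexive (Ω.Eq.sym (E-concat a c c≤a)))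
              (≤E-↾ (NewArg.st x) (Ω.trans c≤d (Ω.reflexive (Ω.Eq.sym (E-st x)))))
              ac∼bd same-type ,
            tupleIso-⊆ s k (λ i → ↦-resp k M.refl (Nₚ.↾-↾-≤ c≤d) (maps (inj₁ i))) ,
            (λ i → Ω.trans (Ω.reflexive (E-at c i)) c≤d) ,
            Ω.Eq.refl ,
            (λ i → maps (inj₂ i))

  -- From membership in `Q` to equal functions.

  iso⇒SameType : ∀ {M N γ} {a : Tuple M γ} {b : Tuple N γ} (h : PartialIso M N) →
                 (∀ i → at a i ⟨ h ⟩↦ at b i) → SameType a b
  iso⇒SameType {N = N} {a = a} h maps = record { exact-same = λ ψ _ f →
    Ω.Eq.trans
      (PartialIso.ψ-preserving h ψ
        (record { at = at a ∘ f ; uniform = λ i j → uniform a (f i) (f j) })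
        (λ k → proj₁ (maps (f k))))
      (Interpretation.ψ-cong N ψ (λ k → proj₂ (maps (f k)))) }

  -- Passes a contribution on to an answer. With `u` for `ac` and `v` for `bd`, the chain runs
  -- through `st ↾ r`, `st ↾ p ↾ q`, `u ↾ q`, `v ↾ q` and `v`. The exponent `q` of an answer and the
  -- extent `r` of its tuple are only equivalent.
  ∼-descend : ∀ {β M N γ e e′ p q r} (x : NewArg γ e)
              {u : Tuple M (γ ⊎ (↓ NewArg.m x))} {v : Tuple N (γ ⊎ (↓ NewArg.m x))}
              (x≤e′ : E (NewArg.t x) ≤ e′ ∧ E (NewArg.s x)) →
              r ≤ p → q ≈Ω r → E v ≈Ω r →
              (NewArg.st x ↾ p) ∼⟨ β ⟩ u → (u ↾ q) ∼⟨ β ⟩ (v ↾ q) →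
              (NewArg.st (rebase x x≤e′) ↾ r) ∼⟨ β ⟩ v
  ∼-descend {N = N} x {v = v} x≤e′ r≤p q≈r v≈r st∼u u∼v =
    ∼-trans (∼-cong λ i → K.sym (K.trans
        (Interpretation.↾-↾-≤ (NewArg.K x) (Ω.trans (Ω.reflexive q≈r) r≤p)) (K.↾-cong K.refl q≈r)))
      (∼-trans (∼-↾ st∼u _) (∼-trans u∼v (∼-cong λ i → Interpretation.↾-absorb N
        (Ω.reflexive (Ω.Eq.trans (E-at v i) (Ω.Eq.trans v≈r (Ω.Eq.sym q≈r)))))))
    where module K = Structure (NewArg.K x)

  -- Contributing tuples can have any extent up to `E a` or `E b`, and the clauses of `Q` answer
  -- those below `p`; so here, unlike in `Realised`, `p` also bounds the extents from above.
  Reflected : Pred (Ord ℓ) (lsuc (lsuc ℓ))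
  Reflected α = ∀ {M N γ} {a : Tuple M γ} {b : Tuple N γ} {p} → E a ≈Ω p → E b ≈Ω p →
                (h : PartialIso M N) → (∀ i → at a i ⟨ h ⟩↦ at b i) → Q α p h → a ∼⟨ α ⟩ b

  reflected : ∀ α → Reflected α
  reflected = All.wfRec ◁-wellFounded _ Reflected step
    where
    step : ∀ α → (∀ {β} → β ◁ α → Reflected β) → Reflected α
    step α ih {M} {N} {γ} {a} {b} {p} a≈p b≈p h maps Qh =
      stages⇒∼ (iso⇒SameType h maps) (λ {β} β◁α →
        stage-intro (congruent β) (Ω.Eq.trans a≈p (Ω.Eq.sym b≈p)) (λ x x≤b →
          Ω.antisym (value-≤ β◁α x x≤b) (value-≥ β◁α x x≤b)))
      where
      module M = Structure M
      module N = Structure N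
      module Mₚ = Interpretation M
      module Nₚ = Interpretation N

      -- On the entries of `a` cut to extent exactly `q`, `k` agrees with `h`; the remaining entries
      -- are given by the answer. The inhabitant of `δ` forces the cut concatenations to have extent
      -- `q`.
      extend : ∀ {β q} {δ : Set ℓ} {c : Tuple M δ} {d : Tuple N δ}
               (c≤a : E c ≤ E a) (d≤b : E d ≤ E b) (k : PartialIso M N) → β ◁ α → δ →
               q ≤ E c → q ≤ E d → Q β q k → RestrictionAt q Of h ⊆ k →
               (∀ i → (at c i M.↾ q) ⟨ k ⟩↦ (at d i N.↾ q)) →
               (concat a c c≤a ↾ q) ∼⟨ β ⟩ (concat b d d≤b ↾ q)
      extend {q = q} {c = c} {d} c≤a d≤b k β◁α i₀ q≤c q≤d Qk h⊆k c↦d = ih β◁α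
        (Ω.antisym (E-↾≤ (concat a c c≤a) q (inj₂ i₀))
          (≤E-↾ (concat a c c≤a) (Ω.trans q≤c (Ω.reflexive (Ω.Eq.sym (E-concat a c c≤a))))))
        (Ω.antisym (E-↾≤ (concat b d d≤b) q (inj₂ i₀))
          (≤E-↾ (concat b d d≤b) (Ω.trans q≤d (Ω.reflexive (Ω.Eq.sym (E-concat b d d≤b))))))
        k ac↦bd Qk
        where
        ac↦bd : ∀ i → at (concat a c c≤a ↾ q) i ⟨ k ⟩↦ at (concat b d d≤b ↾ q) i
        ac↦bd (inj₁ i) = ↦-resp k (M.sym (Mₚ.↾-↾-≤ q≤c)) (N.sym (Nₚ.↾-↾-≤ q≤d))
          (⊆⇒↦ h k h⊆k
            (Mₚ.E-↾-≤ (Ω.trans q≤c (Ω.trans c≤a (Ω.⋀-lower _ i))))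
            (↦-↾ h (maps i) q))
        ac↦bd (inj₂ i) = c↦d i

      value-≤ : ∀ {β} → β ◁ α → ∀ x x≤b → value β M a x ≤ value β N b (rebase x x≤b)
      value-≤ {β} β◁α x x≤b = value-least x λ c c≤t st∼ac →
        let c≤a = Ω.trans c≤t (NewArg.t≤e x)
            (J , k , q , d , properties , ⋁q≈c) = proj₁ (Q⁻ α h Qh β◁α) m nonempty c
              (λ i → Ω.trans (Ω.reflexive (E-at c i)) (Ω.trans c≤a (Ω.reflexive a≈p)))
        in Ω.trans (Ω.reflexive (Ω.Eq.sym ⋁q≈c)) (Ω.⋁-least q _ λ j →
          let (Qk , h⊆k , dᵢ≤c , d≈q , c↦d) = properties j
              q≤d = Ω.reflexive (Ω.Eq.sym d≈q)
              d≤c = E≤-nonempty (d j) nonempty dᵢ≤c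
              d≤b = Ω.trans (Ω.trans d≤c c≤t) (NewArg.t≤e (rebase x x≤b))
              ac∼bd = extend c≤a d≤b (k j) β◁α nonempty (Ω.trans q≤d d≤c) q≤d Qk h⊆k
                (λ i → ↦-resp (k j) M.refl
                  (N.sym (Nₚ.↾-absorb (Ω.reflexive (Ω.Eq.trans (E-at (d j) i) d≈q)))) (c↦d i))
          in Ω.trans q≤d (value-upper (rebase x x≤b) (d j) (Ω.trans d≤c c≤t)
            (∼-descend x x≤b d≤c (Ω.Eq.sym d≈q) (E-concat b (d j) d≤b) st∼ac ac∼bd)))
        where open NewArg x using (m; nonempty)

      -- The mirror image of `value-≤`, through `Back`; `extend` keeps its direction, so its result
      -- is reversed.
      value-≥ : ∀ {β} → β ◁ α → ∀ x x≤b → value β N b (rebase x x≤b) ≤ value β M a x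
      value-≥ {β} β◁α x x≤b = value-least (rebase x x≤b) λ d d≤t st∼bd →
        let d≤b = Ω.trans d≤t (NewArg.t≤e (rebase x x≤b))
            (J , k , q , c , properties , ⋁q≈d) = proj₂ (Q⁻ α h Qh β◁α) m nonempty d
              (λ i → Ω.trans (Ω.reflexive (E-at d i)) (Ω.trans d≤b (Ω.reflexive b≈p)))
        in Ω.trans (Ω.reflexive (Ω.Eq.sym ⋁q≈d)) (Ω.⋁-least q _ λ j →
          let (Qk , h⊆k , cᵢ≤d , c≈q , c↦d) = properties j
              q≤c = Ω.reflexive (Ω.Eq.sym c≈q)
              c≤d = E≤-nonempty (c j) nonempty cᵢ≤d
              c≤a = Ω.trans (Ω.trans c≤d d≤t) (NewArg.t≤e x)
              ac∼bd = extend c≤a d≤b (k j) β◁α nonempty q≤c (Ω.trans q≤c c≤d) Qk h⊆k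
                (λ i → ↦-resp (k j)
                  (M.sym (Mₚ.↾-absorb (Ω.reflexive (Ω.Eq.trans (E-at (c j) i) c≈q)))) N.refl (c↦d i))
          in Ω.trans q≤c (value-upper x (c j) (Ω.trans c≤d d≤t)
            (∼-descend (rebase x x≤b) (NewArg.bound x) c≤d (Ω.Eq.sym c≈q) (E-concat a (c j) c≤a)
              st∼bd (∼-sym ac∼bd))))
        where open NewArg x using (m; nonempty)

  -- For `p` merely below `E a` this can fail on the empty tuple, whose restriction still has extent
  -- `𝟙`. For the meet it holds: without entries, `p` is `𝟙` too.
  E-↾-meet : ∀ {M N γ} (a : Tuple M γ) (b : Tuple N γ) {p} → p ≈Ω E a ∧ E b → E (a ↾ p) ≈Ω p
  E-↾-meet {M} a b {p} p≈ = Ω.antisym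
    (Ω.trans (Ω.∧-greatest (E-↾≤E a p) (Ω.⋀-greatest _ _ λ i →
        Ω.trans (E-↾≤ a p i) (Ω.trans (Ω.reflexive p≈) (Ω.trans (Ω.x∧y≤y _ _) (Ω.⋀-lower _ i)))))
      (Ω.reflexive (Ω.Eq.sym p≈)))
    (≤E-↾ a (Ω.trans (Ω.reflexive p≈) (Ω.x∧y≤x _ _)))

proposition5p9 :
  {ℓ : Level} (Ω : CompleteHeytingAlgebra ℓ) (L : Signature Ω) (μ : Cardinal ℓ) →
  let open CompleteHeytingAlgebra Ω using (_∧_)
      open WithSignature Ω L
      open WithCardinal μ
  in
  (M : Structure) (γ : WellOrder ℓ) (a : Tuple M (WellOrder.Carrier γ)) (α : Ord ℓ)
  (N : Structure) (b : Tuple N (WellOrder.Carrier γ)) →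
  let p = E a ∧ E b
  in
  (F α M (a ↾ p) ≈G F α N (b ↾ p))
  ⇔ (Σ[ h ∈ PartialIso M N ]
       ((∀ i → at (a ↾ p) i ⟨ h ⟩↦ at (b ↾ p) i) × Q α p h))
proposition5p9 Ω L μ M γ a α N b = mk⇔
  (λ Fa≈Fb →
    let a∼b = ∼-intro Fa≈Fb
        s = ∼⇒SameType a∼b in
    tupleIso (a ↾ p) (b ↾ p) s , tupleIso-maps (a ↾ p) (b ↾ p) s ,
    realised α (Ω.reflexive (Ω.Eq.sym Ea≈p)) (Ω.reflexive (Ω.Eq.sym Eb≈p)) a∼b s)
  (λ (h , maps , Qh) → _∼⟨_⟩_.graphs (reflected α Ea≈p Eb≈p h maps Qh))
  where
  module Ω = CompleteHeytingAlgebra Ω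
  open Ω using (_∧_) renaming (_≈_ to _≈Ω_)
  open WithSignature Ω L
  open WithCardinal μ
  open StructureProperties Ω L
  open BackAndForth Ω L μ
  open CompleteHeytingAlgebraProperties Ω using (∧-comm)
  p = E a ∧ E b
  Ea≈p : E (a ↾ p) ≈Ω p
  Ea≈p = E-↾-meet a b Ω.Eq.refl
  Eb≈p : E (b ↾ p) ≈Ω p
  Eb≈p = E-↾-meet b a (∧-comm _ _)
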